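{- Let $w\in S_n$ and let $d=\mathrm{raj}(w)-\mathrm{inv}(w)$. Then for every $0\le i\le d$, the monomial $\mathbf{x}^{L_w(i)}$ appears with nonzero coefficient in the Grothendieck polynomial $\mathfrak{G}_w(x_1,\ldots,x_n)$.
   Context: Grothendieck polynomials. For $j\in[n-1]$, with $s_j$ the adjacent transposition swapping $j$ and $j+1$ (acting on polynomials by exchanging $x_j,x_{j+1}$), let $\partial_j(f)=\frac{f-s_j\cdot f}{x_j-x_{j+1}}$ and $\overline{\partial}_j(f)=\partial_j(f-x_{j+1}f)$ on $\mathbb{Z}[x_1,\ldots,x_n]$. Let $w_0\in S_n$ be the longest permutation, $w_0(k)=n+1-k$. Set $\mathfrak{G}_{w_0}=x_1^{n-1}x_2^{n-2}\cdots x_{n-1}$ and $\mathfrak{G}_w=\overline{\partial}_j\mathfrak{G}_{ws_j}$ whenever $w(j)<w(j+1)$, where $ws_j$ is $w$ with the values in positions $j,j+1$ exchanged. Codes. $\mathrm{invcode}(w)_i=\#\{j>i\mid w(j)<w(i)\}$, $\mathrm{inv}(w)=\sum_i\mathrm{invcode}(w)_i$. $\overline{\mathrm{rajcode}}(w)_i$ is the maximal number $r$ of positions in a sequence $i=\alpha_1<\cdots<\alpha_r\le n$ with $w(\alpha_1)<\cdots<w(\alpha_r)$, minus one. $\mathrm{rajcode}(w)_k=n-k-\overline{\mathrm{rajcode}}(w)_k$ and $\mathrm{raj}(w)=\sum_k\mathrm{rajcode}(w)_k$. One has $\mathrm{rajcode}(w)_k\ge\mathrm{invcode}(w)_k$ for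 all $k$. The vectors $L_w(0),\ldots,L_w(d)$: set $L_w(0)=\mathrm{invcode}(w)$; for $1\le i\le d$ let $j\in[n]$ be the largest index with $L_w(i-1)_j<\mathrm{rajcode}(w)_j$ and set $L_w(i)=L_w(i-1)+e_j$, with $e_j$ the $j$th standard basis vector. $\mathbf{x}^v=\prod_kx_k^{v_k}$. -}

module Defs where

open import Data.Bool.Base using (if_then_else_)
open import Data.Fin.Base using (Fin; toℕ) renaming (_<_ to _<ᶠ_)
open import Data.Fin.Properties using () renaming (_<?_ to _<ᶠ?_)
open import Data.Fin.Permutation
  using (Permutation′; _⟨$⟩ʳ_; transpose; reverse; _∘ₚ_; _≈_)
open import Data.Integer.Base as ℤ using (ℤ; 0ℤ; 1ℤ)
open import Data.List.Base as List using (List; []; _∷_; _++_)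
open import Data.List.Extrema.Nat using (max)
open import Data.List.Relation.Unary.Linked using (Linked; linked?)
open import Data.Maybe.Base using (maybe′)
open import Data.Nat.Base as ℕ using (ℕ; zero; suc; _∸_)
open import Data.Nat.Properties as ℕ using ()
open import Data.Product.Base using (_×_; _,_)
open import Data.Vec.Base as Vec using (Vec; tabulate; lookup; _[_]%=_)
open import Data.Vec.Properties using (≡-dec)
open import Relation.Binary.PropositionalEquality.Core using (_≡_)
open import Relation.Nullary.Decidable using (Dec; does; _×-dec_)

private
  variable
    n : ℕ

Exponent : ℕ → Set
Exponent n = Vec ℕ n

-- ℤ[x₁,…,xₙ], as formal sums of terms c · x^u.  A list may repeat an exponent
-- or contain zero terms, so lists are only ever compared through `coeff`.
Poly : ℕ → Set
Poly n = List (ℤ × Exponent n)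

coeff : Poly n → Exponent n → ℤ
coeff []            v = 0ℤ
coeff ((c , u) ∷ f) v =
  (if does (≡-dec ℕ._≟_ u v) then c else 0ℤ) ℤ.+ coeff f v

infix 4 _≈ₚ_
_≈ₚ_ : Poly n → Poly n → Set
f ≈ₚ g = ∀ v → coeff f v ≡ coeff g v

monomial : Exponent n → Poly n
monomial u = (1ℤ , u) ∷ []

infixl 6 _-ₚ_
_-ₚ_ : Poly n → Poly n → Poly n
f -ₚ g = f ++ List.map (λ { (c , u) → ℤ.- c , u }) g

infixl 7 _*ₚ_
_*ₚ_ : Poly n → Poly n → Poly n
_*ₚ_ = List.cartesianProductWith
  λ { (c , u) (d , v) → c ℤ.* d , Vec.zipWith ℕ._+_ u v }

x : Fin n → Poly n
x j = monomial (Vec.replicate _ 0 [ j ]%= suc)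

swapVars : Fin n → Fin n → Poly n → Poly n
swapVars j k =
  List.map λ { (c , u) → c , tabulate (λ i → lookup u (transpose j k ⟨$⟩ʳ i)) }

-- In the next three definitions k stands for j + 1.  The quotient of
-- polynomials defining ∂ⱼ is exact, and is expressed by the equation it solves:
-- g represents ∂ⱼ f.
Is∂ : Fin n → Fin n → Poly n → Poly n → Set
Is∂ j k f g = (x j -ₚ x k) *ₚ g ≈ₚ f -ₚ swapVars j k f

Is∂̄ : Fin n → Fin n → Poly n → Poly n → Set
Is∂̄ j k f g = Is∂ j k (f -ₚ x k *ₚ f) g

-- (n-1, n-2, …, 1, 0); positions are 0-based.
staircase : Exponent n
staircase {n} = tabulate λ i → n ∸ suc (toℕ i)

-- IsGrothendieck w f : the list f represents 𝔊_w.  Every ascent of w may be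
-- used, and `transpose j k ∘ₚ w` is the map i ↦ w (sⱼ i), i.e. w sⱼ.
data IsGrothendieck {n} (w : Permutation′ n) (f : Poly n) : Set where
  longest : w ≈ reverse → f ≈ₚ monomial staircase → IsGrothendieck w f
  ascent  : ∀ (j k : Fin n) → toℕ k ≡ suc (toℕ j) →
            w ⟨$⟩ʳ j <ᶠ w ⟨$⟩ʳ k →
            (g : Poly n) → IsGrothendieck (transpose j k ∘ₚ w) g →
            Is∂̄ j k g f → IsGrothendieck w f

invcode : Permutation′ n → Vec ℕ n
invcode w = tabulate λ i →
  Vec.count (λ j → (i <ᶠ? j) ×-dec (w ⟨$⟩ʳ j <ᶠ? w ⟨$⟩ʳ i)) (Vec.allFin _)

inv : Permutation′ n → ℕ
inv w = Vec.sum (invcode w)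

sublists : {A : Set} → List A → List (List A)
sublists []       = [] ∷ []
sublists (a ∷ as) = List.map (a ∷_) (sublists as) ++ sublists as

Increasing : Permutation′ n → List (Fin n) → Set
Increasing w = Linked λ a b → (a <ᶠ b) × (w ⟨$⟩ʳ a <ᶠ w ⟨$⟩ʳ b)

increasing? : (w : Permutation′ n) (α : List (Fin n)) → Dec (Increasing w α)
increasing? w = linked? λ a b → (a <ᶠ? b) ×-dec (w ⟨$⟩ʳ a <ᶠ? w ⟨$⟩ʳ b)

-- All sequences i = α₁ < ⋯ < αᵣ with w(α₁) < ⋯ < w(αᵣ).
increasingFrom : Permutation′ n → Fin n → List (List (Fin n))
increasingFrom w i =
  List.filter (increasing? w) (List.map (i ∷_) (sublists (List.allFin _)))

-- The one-element sequence i always occurs, so the maximum is at least 1.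
rajcode‾ : Permutation′ n → Fin n → ℕ
rajcode‾ w i = max 0 (List.map List.length (increasingFrom w i)) ∸ 1

-- For 0-based k the number of later positions is n ∸ suc k, which bounds
-- rajcode‾ w k, so neither subtraction truncates.
rajcode : Permutation′ n → Vec ℕ n
rajcode {n} w = tabulate λ k → (n ∸ suc (toℕ k)) ∸ rajcode‾ w k

raj : Permutation′ n → ℕ
raj w = Vec.sum (rajcode w)

-- `List.last` of the indices in increasing order is the largest one.  If no
-- index qualifies, which happens only from v = rajcode w on, v is kept.
raise : Permutation′ n → Vec ℕ n → Vec ℕ n
raise w v = maybe′ (λ j → v [ j ]%= suc) v
  (List.last (List.filter (λ j → lookup v j ℕ.<? lookup (rajcode w) j)
                          (List.allFin _)))

L : Permutation′ n → ℕ → Vec ℕ n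
L w zero    = invcode w
L w (suc i) = raise w (L w i)

{-# OPTIONS --safe #-}
module Submission where

-- By Fomin and Kirillov, the polynomials 𝔊_w are the coefficients of the
-- product over i of h_{n-2}(xᵢ) ⋯ hᵢ(xᵢ), with hⱼ(x) = 1 + x Tⱼ, in the 0-Hecke
-- algebra with Tⱼ² = -Tⱼ (letters and variables are counted from 0).  The
-- Yang-Baxter equation shows that these coefficients obey the divided
-- difference recursion.  All terms contributing to one coefficient have the same
-- sign, so a monomial occurs as soon as some subword of the product (a pipe
-- dream) has Demazure product w and the right weight.
--
-- Such a subword is found row by row.  Let w = a ∷ w′.  The first row acts on
-- the values, by one partial bubbling pass that turns 0 ∷ suc v into w; for v
-- the flattening of w′ it needs invcode(w)₁ letters.  If c lies between
-- invcode(w)₁ and rajcode(w)₁, a greedy choice gives a pass with c letters and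
-- a permutation v with rajcode(v) = rajcode(w′).  The vectors L_w(i) are built
-- from exactly these two moves.

open import Data.Bool.Base using (Bool; true; false; if_then_else_; T)
open import Data.Empty using (⊥; ⊥-elim)
open import Data.Fin.Base as Fin using (Fin; zero; suc; toℕ)
open import Data.Fin.Permutation using (Permutation′; _⟨$⟩ʳ_; _∘ₚ_)
import Data.Fin.Permutation as Permutation
open import Data.Fin.Permutation.Components using (transpose)
import Data.Fin.Properties as Fin
open import Data.Integer.Base as ℤ using (ℤ; 0ℤ; 1ℤ)
import Data.Integer.Properties as ℤ
open import Data.Integer.Tactic.RingSolver using (solve-∀)
open import Data.List.Base as List using (List; []; _∷_; _++_)
open import Data.List.Extrema.Nat using (max; max≤v⁺; xs≤max)
import Data.List.Properties as List
open import Data.List.Relation.Unary.All as All using (All; []; _∷_)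
import Data.List.Relation.Unary.All.Properties as All
open import Data.Maybe.Base as Maybe using (Maybe; just; nothing; maybe′)
open import Data.Nat.Base as ℕ
  using (ℕ; zero; suc; _≤_; _<_; z≤n; s≤s; _∸_; _⊔_; _<ᵇ_; pred)
import Data.Nat.Properties as ℕ
open import Data.Product.Base using (∃; _×_; _,_; proj₁; proj₂; map₁; map₂)
open import Data.Sum.Base using (_⊎_; inj₁; inj₂)
open import Data.Unit.Base using (⊤; tt)
open import Data.Vec.Base as Vec
  using (Vec; []; _∷_; lookup; _[_]%=_; replicate; tabulate; map; _∷ʳ_)
open import Data.Vec.Membership.Propositional using (_∈_)
open import Data.Vec.Membership.Propositional.Properties using (∈-map⁺)
import Data.Vec.Properties as Vec
open import Data.Vec.Relation.Unary.All as VAll using ([]; _∷_) renaming (All to VAll)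
import Data.Vec.Relation.Unary.All.Properties as VAllₚ
open import Data.Vec.Relation.Unary.AllPairs using ([]; _∷_)
open import Data.Vec.Relation.Unary.Any using (here; there)
open import Data.Vec.Relation.Unary.Unique.Propositional using (Unique)
import Data.Vec.Relation.Unary.Unique.Propositional.Properties as Unique
open import Function.Base using (_∘_; id)
open import Function.Bundles using (module Injection)
open import Function.Properties.Inverse using (↔⇒↣)
open import Relation.Binary.Definitions using (tri<; tri≈; tri>)
open import Relation.Binary.PropositionalEquality
open import Relation.Nullary.Decidable using (Dec; does; yes; no; dec-true; dec-false; _×-dec_)
open import Relation.Nullary.Negation.Core using (¬_)
open import Relation.Unary using (Decidable)
open import Defs using (Poly; coeff; _-ₚ_; _*ₚ_; swapVars; staircase; IsGrothendieck; longest; ascent;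
  invcode; inv; sublists; increasing?; rajcode‾; rajcode; raj; L)
import Defs

-- The first row is read first, yet it has to act on the values of the final word. This works
-- because left and right multiplication by a letter agree on the identity, and because left
-- Demazure multiplication commutes with right multiplication. The obstacle is that a pass with more
-- than invcode(w)₁ letters may leave a permutation `v` other than the flattening of w′. Only the
-- ranks are kept, that is, the lengths of the longest increasing sequences starting at each
-- position. They determine the raj code, and this is enough because the tail of L_w(i) is already
-- maximal once its first entry has been raised. The bound rajcode(w)₁ is the number of letters of
-- the row minus the longest increasing sequence above `a`.

private
  variable
    n m : ℕ

-- The 0-Hecke algebra on coefficient functions

-- Right multiplication by Tⱼ in the 0-Hecke algebra with Tⱼ² = - Tⱼ, on
-- coefficient functions of one-line words.
𝕋 : ℕ → (Vec ℕ n → ℤ) → Vec ℕ n → ℤ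
𝕋 j       Φ []          = 0ℤ
𝕋 zero    Φ (a ∷ [])    = 0ℤ
𝕋 zero    Φ (a ∷ b ∷ w) =
  if b <ᵇ a then Φ (b ∷ a ∷ w) ℤ.- Φ (a ∷ b ∷ w) else 0ℤ
𝕋 (suc j) Φ (a ∷ w)     = 𝕋 j (λ u → Φ (a ∷ u)) w

data Descent : ∀ {n} → ℕ → Vec ℕ n → Vec ℕ n → Set where
  here  : ∀ {a b} {w : Vec ℕ n} → b < a → Descent 0 (a ∷ b ∷ w) (b ∷ a ∷ w)
  there : ∀ {j a} {w w′ : Vec ℕ n} → Descent j w w′ → Descent (suc j) (a ∷ w) (a ∷ w′)

<⇒<ᵇ≡true : ∀ {a b} → a < b → (a <ᵇ b) ≡ true
<⇒<ᵇ≡true {a} {b} p with a <ᵇ b | ℕ.<⇒<ᵇ p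
... | true | _ = refl

<ᵇ≡true⇒< : ∀ a b → (a <ᵇ b) ≡ true → a < b
<ᵇ≡true⇒< a b p = ℕ.<ᵇ⇒< a b (subst T (sym p) _)

≮⇒<ᵇ≡false : ∀ {a b} → ¬ a < b → (a <ᵇ b) ≡ false
≮⇒<ᵇ≡false {a} {b} p with a <ᵇ b in eq
... | true  = ⊥-elim (p (<ᵇ≡true⇒< a b eq))
... | false = refl

<ᵇ≡false⇒≥ : ∀ a b → (a <ᵇ b) ≡ false → b ≤ a
<ᵇ≡false⇒≥ a b p = ℕ.≮⇒≥ λ q → case (trans (sym (<⇒<ᵇ≡true q)) p)
  where
  case : true ≡ false → ⊥
  case ()

>ᵇ⇒≮ᵇ : ∀ a b → (b <ᵇ a) ≡ true → (a <ᵇ b) ≡ false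
>ᵇ⇒≮ᵇ a b p = ≮⇒<ᵇ≡false (ℕ.<-asym (<ᵇ≡true⇒< b a p))

-- Which alternative holds depends on the word alone and not on `Φ`, so an identity between several
-- coefficient functions needs a single case split.
𝕋-view : ∀ j (w : Vec ℕ n) →
  (∃ λ w′ → Descent j w w′ × (∀ Φ → 𝕋 j Φ w ≡ Φ w′ ℤ.- Φ w)) ⊎ (∀ Φ → 𝕋 j Φ w ≡ 0ℤ)
𝕋-view j       []          = inj₂ λ _ → refl
𝕋-view zero    (a ∷ [])    = inj₂ λ _ → refl
𝕋-view zero    (a ∷ b ∷ w) with b <ᵇ a in eq
... | true  = inj₁ (_ , here (<ᵇ≡true⇒< b a eq) , λ _ → refl)
... | false = inj₂ λ _ → refl
𝕋-view (suc j) (a ∷ w) with 𝕋-view j w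
... | inj₁ (w′ , d , e) = inj₁ (a ∷ w′ , there d , λ Φ → e _)
... | inj₂ e            = inj₂ λ Φ → e _

𝕋-descent : ∀ {j} {w w′ : Vec ℕ n} → Descent j w w′ → ∀ Φ → 𝕋 j Φ w ≡ Φ w′ ℤ.- Φ w
𝕋-descent (here p)  Φ rewrite <⇒<ᵇ≡true p = refl
𝕋-descent (there d) Φ = 𝕋-descent d _

𝕋-ascent : ∀ {j} {w w′ : Vec ℕ n} → Descent j w w′ → ∀ Φ → 𝕋 j Φ w′ ≡ 0ℤ
𝕋-ascent (here p)  Φ rewrite ≮⇒<ᵇ≡false (ℕ.<-asym p) = refl
𝕋-ascent (there d) Φ = 𝕋-ascent d _

𝕋-cong : ∀ j {Φ Ψ : Vec ℕ n → ℤ} → (∀ w → Φ w ≡ Ψ w) → ∀ w → 𝕋 j Φ w ≡ 𝕋 j Ψ w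
𝕋-cong j {Φ} {Ψ} eq w with 𝕋-view j w
... | inj₁ (w′ , _ , e) = trans (e Φ) (trans (cong₂ ℤ._-_ (eq w′) (eq w)) (sym (e Ψ)))
... | inj₂ e            = trans (e Φ) (sym (e Ψ))

𝕋-+ : ∀ j (Φ Ψ : Vec ℕ n → ℤ) w →
  𝕋 j (λ u → Φ u ℤ.+ Ψ u) w ≡ 𝕋 j Φ w ℤ.+ 𝕋 j Ψ w
𝕋-+ j Φ Ψ w with 𝕋-view j w
... | inj₁ (w′ , _ , e) rewrite e Φ | e Ψ | e (λ u → Φ u ℤ.+ Ψ u) =
  lemma (Φ w′) (Ψ w′) (Φ w) (Ψ w)
  where
  lemma : ∀ a b c d → (a ℤ.+ b) ℤ.- (c ℤ.+ d) ≡ (a ℤ.- c) ℤ.+ (b ℤ.- d)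
  lemma = solve-∀
... | inj₂ e rewrite e Φ | e Ψ | e (λ u → Φ u ℤ.+ Ψ u) = refl

𝕋-- : ∀ j (Φ Ψ : Vec ℕ n → ℤ) w →
  𝕋 j (λ u → Φ u ℤ.- Ψ u) w ≡ 𝕋 j Φ w ℤ.- 𝕋 j Ψ w
𝕋-- j Φ Ψ w with 𝕋-view j w
... | inj₁ (w′ , _ , e) rewrite e Φ | e Ψ | e (λ u → Φ u ℤ.- Ψ u) =
  lemma (Φ w′) (Ψ w′) (Φ w) (Ψ w)
  where
  lemma : ∀ a b c d → (a ℤ.- b) ℤ.- (c ℤ.- d) ≡ (a ℤ.- c) ℤ.- (b ℤ.- d)
  lemma = solve-∀
... | inj₂ e rewrite e Φ | e Ψ | e (λ u → Φ u ℤ.- Ψ u) = refl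

𝕋-idem : ∀ j (Φ : Vec ℕ n → ℤ) w → 𝕋 j (𝕋 j Φ) w ≡ ℤ.- 𝕋 j Φ w
𝕋-idem j Φ w with 𝕋-view j w
... | inj₁ (w′ , d , e) rewrite e (𝕋 j Φ) | 𝕋-ascent d Φ = ℤ.+-identityˡ _
... | inj₂ e rewrite e (𝕋 j Φ) | e Φ = refl

-- Only the order pattern of three neighbouring entries matters. A decreasing triple compares the
-- same six rearrangements on both sides; for every other consistent pattern both sides vanish.
𝕋-braid : ∀ j (Φ : Vec ℕ n → ℤ) w →
  𝕋 j (𝕋 (suc j) (𝕋 j Φ)) w ≡ 𝕋 (suc j) (𝕋 j (𝕋 (suc j) Φ)) w
𝕋-braid j       Φ []               = refl
𝕋-braid zero    Φ (a ∷ [])         = refl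
𝕋-braid zero    Φ (a ∷ b ∷ [])     with b <ᵇ a
... | true  = refl
... | false = refl
𝕋-braid zero    Φ (a ∷ b ∷ c ∷ w) with b <ᵇ a in ba | c <ᵇ b in cb | c <ᵇ a in ca
... | true | true | true rewrite >ᵇ⇒≮ᵇ b c cb | >ᵇ⇒≮ᵇ a b ba =
  lemma (Φ (a ∷ b ∷ c ∷ w)) (Φ (b ∷ a ∷ c ∷ w)) (Φ (a ∷ c ∷ b ∷ w))
        (Φ (b ∷ c ∷ a ∷ w)) (Φ (c ∷ a ∷ b ∷ w)) (Φ (c ∷ b ∷ a ∷ w))
  where
  lemma : ∀ abc bac acb bca cab cba →
    cba ℤ.- bca ℤ.- 0ℤ ℤ.- (cab ℤ.- acb ℤ.- (bac ℤ.- abc)) ≡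
    cba ℤ.- cab ℤ.- 0ℤ ℤ.- (bca ℤ.- bac ℤ.- (acb ℤ.- abc))
  lemma = solve-∀
... | true | true | false =
  ⊥-elim (ℕ.<⇒≱ (ℕ.<-trans (<ᵇ≡true⇒< c b cb) (<ᵇ≡true⇒< b a ba)) (<ᵇ≡false⇒≥ c a ca))
... | true | false | true rewrite >ᵇ⇒≮ᵇ a b ba = refl
... | true | false | false = refl
... | false | true | true rewrite >ᵇ⇒≮ᵇ b c cb = refl
... | false | true | false = refl
... | false | false | true =
  ⊥-elim (ℕ.<⇒≱ (<ᵇ≡true⇒< c a ca) (ℕ.≤-trans (<ᵇ≡false⇒≥ b a ba) (<ᵇ≡false⇒≥ c b cb)))
... | false | false | false = refl
𝕋-braid (suc j) Φ (a ∷ w) = 𝕋-braid j (λ u → Φ (a ∷ u)) w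

-- The index `2 + d + j` expresses distance at least two without a side condition.
𝕋-far : ∀ j d (Φ : Vec ℕ n → ℤ) w →
  𝕋 j (𝕋 (2 ℕ.+ d ℕ.+ j) Φ) w ≡ 𝕋 (2 ℕ.+ d ℕ.+ j) (𝕋 j Φ) w
𝕋-far j d Φ [] = refl
𝕋-far zero d Φ (a ∷ []) = refl
𝕋-far zero d Φ (a ∷ b ∷ w) rewrite ℕ.+-identityʳ d with b <ᵇ a
... | true  = sym (𝕋-- d (λ u → Φ (b ∷ a ∷ u)) (λ u → Φ (a ∷ b ∷ u)) w)
... | false with 𝕋-view d w
...   | inj₁ (w′ , _ , e) = sym (e (λ _ → 0ℤ))
...   | inj₂ e            = sym (e (λ _ → 0ℤ))
𝕋-far (suc j) d Φ (a ∷ w) rewrite ℕ.+-suc d j = 𝕋-far j d (λ u → Φ (a ∷ u)) w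

-- The Yang-Baxter equation

-- The coefficient function of xᵢ F.
X : Fin m → (Vec ℕ m → ℤ) → Vec ℕ m → ℤ
X zero    F (zero  ∷ α) = 0ℤ
X zero    F (suc c ∷ α) = F (c ∷ α)
X (suc i) F (c ∷ α)     = X i (λ β → F (c ∷ β)) α

X-inc : ∀ (i : Fin m) F β → X i F (β [ i ]%= suc) ≡ F β
X-inc zero    F (c ∷ β) = refl
X-inc (suc i) F (c ∷ β) = X-inc i (λ β → F (c ∷ β)) β

X-view : ∀ (i : Fin m) α →
  (lookup α i ≡ 0 × (∀ F → X i F α ≡ 0ℤ)) ⊎ (∃ λ β → α ≡ β [ i ]%= suc)
X-view zero    (zero  ∷ α) = inj₁ (refl , λ _ → refl)
X-view zero    (suc c ∷ α) = inj₂ (c ∷ α , refl)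
X-view (suc i) (c ∷ α) with X-view i α
... | inj₁ (e , z)    = inj₁ (e , λ F → z _)
... | inj₂ (β , refl) = inj₂ (c ∷ β , refl)

X-0 : ∀ (i : Fin m) α → X i (λ _ → 0ℤ) α ≡ 0ℤ
X-0 i α with X-view i α
... | inj₁ (_ , z)    = z _
... | inj₂ (β , refl) = X-inc i _ β

X-comm : ∀ (i k : Fin m) F α → X i (X k F) α ≡ X k (X i F) α
X-comm zero    zero    F α           = refl
X-comm zero    (suc k) F (zero  ∷ α) = sym (X-0 k α)
X-comm zero    (suc k) F (suc c ∷ α) = refl
X-comm (suc i) zero    F (zero  ∷ α) = X-0 i α
X-comm (suc i) zero    F (suc c ∷ α) = refl
X-comm (suc i) (suc k) F (c ∷ α)     = X-comm i k (λ β → F (c ∷ β)) α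

-- Elements of the 0-Hecke algebra with power series coefficients. No finiteness is imposed, since
-- the operators below compute each coefficient from finitely many others.
Series : ℕ → ℕ → Set
Series n m = Vec ℕ n → Vec ℕ m → ℤ

infix 4 _≐_
_≐_ : Series n m → Series n m → Set
Φ ≐ Ψ = ∀ w α → Φ w α ≡ Ψ w α

infixl 6 _⊕_ _⊖_
opaque
  _⊕_ _⊖_ : Series n m → Series n m → Series n m
  (Φ ⊕ Ψ) w α = Φ w α ℤ.+ Ψ w α
  (Φ ⊖ Ψ) w α = Φ w α ℤ.- Ψ w α

  ⊕-at : ∀ (Φ Ψ : Series n m) w α → (Φ ⊕ Ψ) w α ≡ Φ w α ℤ.+ Ψ w α
  ⊕-at Φ Ψ w α = refl

-- `cong-≐` is a field of its own because series are compared pointwise, which an arbitrary operator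
-- on functions need not respect.
record Linear (O : Series n m → Series n m) : Set where
  field
    cong-≐ : ∀ {Φ Ψ} → Φ ≐ Ψ → O Φ ≐ O Ψ
    ⊕-hom  : ∀ Φ Ψ → O (Φ ⊕ Ψ) ≐ O Φ ⊕ O Ψ
    ⊖-hom  : ∀ Φ Ψ → O (Φ ⊖ Ψ) ≐ O Φ ⊖ O Ψ

open Linear

x : Fin m → Series n m → Series n m
x i Φ w α = X i (Φ w) α

t : ℕ → Series n m → Series n m
t j Φ w α = 𝕋 j (λ u → Φ u α) w

opaque
  unfolding _⊕_

  x-linear : ∀ (i : Fin m) → Linear (x {m} {n} i)
  x-linear i .cong-≐ {Φ} {Ψ} e w α with X-view i α
  ... | inj₁ (_ , z)    = trans (z _) (sym (z _))
  ... | inj₂ (β , refl) = trans (X-inc i _ β) (trans (e w β) (sym (X-inc i _ β)))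
  x-linear i .⊕-hom Φ Ψ w α with X-view i α
  ... | inj₁ (_ , z) rewrite z (Φ w) | z (Ψ w) | z ((Φ ⊕ Ψ) w) = refl
  ... | inj₂ (β , refl)
        rewrite X-inc i (Φ w) β | X-inc i (Ψ w) β | X-inc i ((Φ ⊕ Ψ) w) β = refl
  x-linear i .⊖-hom Φ Ψ w α with X-view i α
  ... | inj₁ (_ , z) rewrite z (Φ w) | z (Ψ w) | z ((Φ ⊖ Ψ) w) = refl
  ... | inj₂ (β , refl)
        rewrite X-inc i (Φ w) β | X-inc i (Ψ w) β | X-inc i ((Φ ⊖ Ψ) w) β = refl

  t-linear : ∀ j → Linear (t {n} {m} j)
  t-linear j .cong-≐ e w α  = 𝕋-cong j (λ u → e u α) w
  t-linear j .⊕-hom Φ Ψ w α = 𝕋-+ j _ _ w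
  t-linear j .⊖-hom Φ Ψ w α = 𝕋-- j _ _ w

𝕋-0 : ∀ j (w : Vec ℕ n) → 𝕋 j (λ _ → 0ℤ) w ≡ 0ℤ
𝕋-0 j w with 𝕋-view j w
... | inj₁ (_ , _ , e) = e _
... | inj₂ e           = e _

t-x : ∀ j i (Φ : Series n m) → t j (x i Φ) ≐ x i (t j Φ)
t-x j i Φ w α with X-view i α
... | inj₁ (_ , z) = trans (𝕋-cong j (λ u → z (Φ u)) w) (trans (𝕋-0 j w) (sym (z _)))
... | inj₂ (β , refl) =
  trans (𝕋-cong j (λ u → X-inc i (Φ u) β) w) (sym (X-inc i (t j Φ w) β))

h : ℕ × Fin m → Series n m → Series n m
h (j , i) Φ = Φ ⊕ x i (t j Φ)

-- The head of the list is the leftmost factor of the product, so it multiplies first.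
run : List (ℕ × Fin m) → Series n m → Series n m
run []      Φ = Φ
run (l ∷ r) Φ = run r (h l Φ)

module _ {n m : ℕ} where

  ≐-refl : {Φ : Series n m} → Φ ≐ Φ
  ≐-refl w α = refl

  ≐-sym : {Φ Ψ : Series n m} → Φ ≐ Ψ → Ψ ≐ Φ
  ≐-sym e w α = sym (e w α)

  infixr 5 _⟫_
  _⟫_ : {Φ Ψ Θ : Series n m} → Φ ≐ Ψ → Ψ ≐ Θ → Φ ≐ Θ
  (e ⟫ f) w α = trans (e w α) (f w α)

  opaque
    unfolding _⊕_

    ⊕-cong : {Φ Φ′ Ψ Ψ′ : Series n m} → Φ ≐ Φ′ → Ψ ≐ Ψ′ → Φ ⊕ Ψ ≐ Φ′ ⊕ Ψ′
    ⊕-cong e f w α = cong₂ ℤ._+_ (e w α) (f w α)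

    ⊖-cong : {Φ Φ′ Ψ Ψ′ : Series n m} → Φ ≐ Φ′ → Ψ ≐ Ψ′ → Φ ⊖ Ψ ≐ Φ′ ⊖ Ψ′
    ⊖-cong e f w α = cong₂ ℤ._-_ (e w α) (f w α)

  x-comm : ∀ i k (Φ : Series n m) → x i (x k Φ) ≐ x k (x i Φ)
  x-comm i k Φ w α = X-comm i k (Φ w) α

  ∘-linear : {O P : Series n m → Series n m} → Linear O → Linear P → Linear (O ∘ P)
  ∘-linear o p .cong-≐ e    = cong-≐ o (cong-≐ p e)
  ∘-linear o p .⊕-hom Φ Ψ   = cong-≐ o (⊕-hom p Φ Ψ) ⟫ ⊕-hom o _ _
  ∘-linear o p .⊖-hom Φ Ψ   = cong-≐ o (⊖-hom p Φ Ψ) ⟫ ⊖-hom o _ _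

  opaque
    unfolding _⊕_

    ⊕-linear : {O P : Series n m → Series n m} → Linear O → Linear P → Linear (λ Φ → O Φ ⊕ P Φ)
    ⊕-linear o p .cong-≐ e w α = cong₂ ℤ._+_ (cong-≐ o e w α) (cong-≐ p e w α)
    ⊕-linear {O} {P} o p .⊕-hom Φ Ψ w α
      rewrite ⊕-hom o Φ Ψ w α | ⊕-hom p Φ Ψ w α = interchange (O Φ w α) (O Ψ w α) (P Φ w α) (P Ψ w α)
      where
      interchange : ∀ a b c d → (a ℤ.+ b) ℤ.+ (c ℤ.+ d) ≡ (a ℤ.+ c) ℤ.+ (b ℤ.+ d)
      interchange = solve-∀
    ⊕-linear {O} {P} o p .⊖-hom Φ Ψ w α
      rewrite ⊖-hom o Φ Ψ w α | ⊖-hom p Φ Ψ w α = interchange (O Φ w α) (O Ψ w α) (P Φ w α) (P Ψ w α)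
      where
      interchange : ∀ a b c d → (a ℤ.- b) ℤ.+ (c ℤ.- d) ≡ (a ℤ.+ c) ℤ.- (b ℤ.+ d)
      interchange = solve-∀

    ⊖-linear : {O P : Series n m → Series n m} → Linear O → Linear P → Linear (λ Φ → O Φ ⊖ P Φ)
    ⊖-linear o p .cong-≐ e w α = cong₂ ℤ._-_ (cong-≐ o e w α) (cong-≐ p e w α)
    ⊖-linear {O} {P} o p .⊕-hom Φ Ψ w α
      rewrite ⊕-hom o Φ Ψ w α | ⊕-hom p Φ Ψ w α = interchange (O Φ w α) (O Ψ w α) (P Φ w α) (P Ψ w α)
      where
      interchange : ∀ a b c d → (a ℤ.+ b) ℤ.- (c ℤ.+ d) ≡ (a ℤ.- c) ℤ.+ (b ℤ.- d)
      interchange = solve-∀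
    ⊖-linear {O} {P} o p .⊖-hom Φ Ψ w α
      rewrite ⊖-hom o Φ Ψ w α | ⊖-hom p Φ Ψ w α = interchange (O Φ w α) (O Ψ w α) (P Φ w α) (P Ψ w α)
      where
      interchange : ∀ a b c d → (a ℤ.- b) ℤ.- (c ℤ.- d) ≡ (a ℤ.- c) ℤ.- (b ℤ.- d)
      interchange = solve-∀

    id-linear : Linear {n} {m} (λ Φ → Φ)
    id-linear .cong-≐ e    = e
    id-linear .⊕-hom Φ Ψ w α = refl
    id-linear .⊖-hom Φ Ψ w α = refl

  h-linear : ∀ l → Linear {n} {m} (h l)
  h-linear (j , i) = ⊕-linear id-linear (∘-linear (x-linear i) (t-linear j))

  run-linear : ∀ r → Linear {n} {m} (run r)
  run-linear []      = id-linear
  run-linear (l ∷ r) = ∘-linear (run-linear r) (h-linear l)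

  run-++ : ∀ r s (Φ : Series n m) → run (r ++ s) Φ ≡ run s (run r Φ)
  run-++ []      s Φ = refl
  run-++ (l ∷ r) s Φ = run-++ r s (h l Φ)

  Commute : (O P : Series n m → Series n m) → Set
  Commute O P = ∀ Φ → O (P Φ) ≐ P (O Φ)

  ∘-commute : ∀ {O P Q} → Linear P → Commute O P → Commute O Q → Commute O (P ∘ Q)
  ∘-commute p op oq Φ = op _ ⟫ cong-≐ p (oq Φ)

  h-commute : ∀ {O} → Linear O → ∀ j i →
    Commute O (x i) → Commute O (t j) → Commute O (h (j , i))
  h-commute {O} o j i ox ot Φ =
    ⊕-hom o _ _ ⟫ ⊕-cong ≐-refl (ox _ ⟫ cong-≐ (x-linear i) (ot Φ))

  run-commute : ∀ {O} → Linear O → ∀ r → All (λ l → Commute O (h l)) r → Commute O (run r)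
  run-commute o []      []       Φ = ≐-refl
  run-commute o (l ∷ r) (c ∷ cs) Φ = run-commute o r cs _ ⟫ cong-≐ (run-linear r) (c Φ)

  commute-sym : ∀ {O P} → Commute O P → Commute P O
  commute-sym c Φ = ≐-sym (c Φ)

  -- g p i k is right multiplication by 1 - xᵢ - (xᵢ - xₖ) Tₚ, that is, by
  -- (1 - xᵢ) h_p(y) with y = (xₖ - xᵢ) / (1 - xᵢ).
  g : ℕ → Fin m → Fin m → Series n m → Series n m
  g p i k Φ = Φ ⊖ x i Φ ⊖ x i (t p Φ) ⊕ x k (t p Φ)

  g-linear : ∀ p i k → Linear (g p i k)
  g-linear p i k = ⊕-linear (⊖-linear (⊖-linear id-linear (x-linear i))
    (∘-linear (x-linear i) (t-linear p))) (∘-linear (x-linear k) (t-linear p))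

  1-x : Fin m → Series n m → Series n m
  1-x i Φ = Φ ⊖ x i Φ

  1-x-linear : ∀ i → Linear (1-x i)
  1-x-linear i = ⊖-linear id-linear (x-linear i)

  x-1-x : ∀ i k → Commute (1-x i) (x k)
  x-1-x i k Φ = ≐-sym (⊖-hom (x-linear k) _ _ ⟫ ⊖-cong ≐-refl (x-comm k i Φ))

  t-1-x : ∀ i j → Commute (1-x i) (t j)
  t-1-x i j Φ = ≐-sym (⊖-hom (t-linear j) _ _ ⟫ ⊖-cong ≐-refl (t-x j i Φ))

  h-1-x : ∀ i l → Commute (1-x i) (h l)
  h-1-x i (j , k) = h-commute (1-x-linear i) j k (x-1-x i k) (t-1-x i j)

  t-far : ∀ p d → Commute (t p) (t (2 ℕ.+ d ℕ.+ p))
  t-far p d Φ w α = 𝕋-far p d _ w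

  g-x : ∀ p i k l → Commute (g p i k) (x l)
  g-x p i k l Φ = ≐-sym (⊕-hom X′ _ _ ⟫ ⊕-cong
    (⊖-hom X′ _ _ ⟫ ⊖-cong (⊖-hom X′ _ _ ⟫ ⊖-cong ≐-refl (x-comm l i Φ)) (xt i))
    (xt k))
    where
    X′ = x-linear l
    xt : ∀ i → x l (x i (t p Φ)) ≐ x i (t p (x l Φ))
    xt i = x-comm l i _ ⟫ cong-≐ (x-linear i) (≐-sym (t-x p l Φ))

  g-t : ∀ p i k d → Commute (g p i k) (t (2 ℕ.+ d ℕ.+ p))
  g-t p i k d Φ = ≐-sym (⊕-hom T′ _ _ ⟫ ⊕-cong
    (⊖-hom T′ _ _ ⟫ ⊖-cong (⊖-hom T′ _ _ ⟫ ⊖-cong ≐-refl (t-x _ i Φ)) (txt i))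
    (txt k))
    where
    T′ = t-linear (2 ℕ.+ d ℕ.+ p)
    txt : ∀ i → t (2 ℕ.+ d ℕ.+ p) (x i (t p Φ)) ≐ x i (t p (t (2 ℕ.+ d ℕ.+ p) Φ))
    txt i = t-x _ i _ ⟫ cong-≐ (x-linear i) (≐-sym (t-far p d Φ))

  h-far : ∀ p d i k → Commute (h (p , i)) (h (2 ℕ.+ d ℕ.+ p , k))
  h-far p d i k = h-commute (h-linear (p , i)) _ k
    (commute-sym {x k} {h (p , i)} (h-commute (x-linear k) p i (x-comm k i) (λ Φ → ≐-sym (t-x p k Φ))))
    (commute-sym {t (2 ℕ.+ d ℕ.+ p)} {h (p , i)} (h-commute (t-linear _) p i (t-x _ i) (λ Φ → ≐-sym (t-far p d Φ))))

  g-far : ∀ p i k d l → Commute (g p i k) (h (2 ℕ.+ d ℕ.+ p , l))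
  g-far p i k d l = h-commute (g-linear p i k) _ l (g-x p i k l) (g-t p i k d)

  t-h : ∀ q p i Φ → t q (h (p , i) Φ) ≐ t q Φ ⊕ x i (t q (t p Φ))
  t-h q p i Φ = ⊕-hom (t-linear q) _ _ ⟫ ⊕-cong ≐-refl (t-x q i _)

  t-g : ∀ q p i k Φ →
    t q (g p i k Φ) ≐ t q Φ ⊖ x i (t q Φ) ⊖ x i (t q (t p Φ)) ⊕ x k (t q (t p Φ))
  t-g q p i k Φ = ⊕-hom T′ _ _ ⟫ ⊕-cong
    (⊖-hom T′ _ _ ⟫ ⊖-cong (⊖-hom T′ _ _ ⟫ ⊖-cong ≐-refl (t-x q i Φ)) (t-x q i _))
    (t-x q k _)
    where T′ = t-linear q

  0ₛ : Series n m
  0ₛ w α = 0ℤ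

  opaque
    unfolding _⊕_

    t-idem : ∀ p (Φ : Series n m) → t p (t p Φ) ≐ 0ₛ ⊖ t p Φ
    t-idem p Φ w α = trans (𝕋-idem p _ w) (sym (ℤ.+-identityˡ _))

    x-neg : ∀ i (Φ : Series n m) → x i (0ₛ ⊖ Φ) ≐ 0ₛ ⊖ x i Φ
    x-neg i Φ w α = trans (⊖-hom (x-linear i) 0ₛ Φ w α) (cong (ℤ._- x i Φ w α) (X-0 i α))

    ⊕-neg : ∀ (Φ Ψ : Series n m) → Φ ⊕ (0ₛ ⊖ Ψ) ≐ Φ ⊖ Ψ
    ⊕-neg Φ Ψ w α = cong (λ c → Φ w α ℤ.+ c) (ℤ.+-identityˡ _)

    h-g-ring : ∀ (A XA Xp XXp Yp YXp : Series n m) →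
      A ⊕ Xp ⊖ (XA ⊕ XXp) ⊖ (Xp ⊖ XXp) ⊕ (Yp ⊖ YXp) ≐ A ⊕ Yp ⊖ (XA ⊕ YXp)
    h-g-ring A XA Xp XXp Yp YXp w α =
      ring (A w α) (XA w α) (Xp w α) (XXp w α) (Yp w α) (YXp w α)
      where
      ring : ∀ A XA Xp XXp Yp YXp →
        A ℤ.+ Xp ℤ.- (XA ℤ.+ XXp) ℤ.- (Xp ℤ.- XXp) ℤ.+ (Yp ℤ.- YXp) ≡
        A ℤ.+ Yp ℤ.- (XA ℤ.+ YXp)
      ring = solve-∀

    t-g-ring : ∀ (P XP YP : Series n m) → P ⊖ XP ⊖ (0ₛ ⊖ XP) ⊕ (0ₛ ⊖ YP) ≐ P ⊖ YP
    t-g-ring P XP YP w α = ring (P w α) (XP w α) (YP w α)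
      where
      ring : ∀ P XP YP → P ℤ.- XP ℤ.- (0ℤ ℤ.- XP) ℤ.+ (0ℤ ℤ.- YP) ≡ P ℤ.- YP
      ring = solve-∀

  x-t-idem : ∀ i p (Φ : Series n m) → x i (t p (t p Φ)) ≐ 0ₛ ⊖ x i (t p Φ)
  x-t-idem i p Φ = cong-≐ (x-linear i) (t-idem p Φ) ⟫ x-neg i _

  t-h-idem : ∀ p i (Φ : Series n m) → t p (h (p , i) Φ) ≐ t p Φ ⊖ x i (t p Φ)
  t-h-idem p i Φ = t-h p p i Φ ⟫ ⊕-cong ≐-refl (x-t-idem i p Φ) ⟫ ⊕-neg _ _

  -- Since Tₚ² = -Tₚ, h_p(a) h_p(b) = h_p(a + b - ab). For a = xᵢ and b = (xₖ - xᵢ) / (1 - xᵢ) the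
  -- parameter on the right is xₖ; the factor 1 - xᵢ clears the denominator.
  h-g : ∀ p i k (Φ : Series n m) → g p i k (h (p , i) Φ) ≐ 1-x i (h (p , k) Φ)
  h-g p i k Φ = ⊕-cong
    (⊖-cong (⊖-cong ≐-refl (⊕-hom (x-linear i) _ _))
      (cong-≐ (x-linear i) (t-h-idem p i Φ) ⟫ ⊖-hom (x-linear i) _ _))
    (cong-≐ (x-linear k) (t-h-idem p i Φ) ⟫ ⊖-hom (x-linear k) _ _) ⟫
    h-g-ring _ _ _ _ _ _ ⟫
    ⊖-cong ≐-refl (≐-sym (⊕-hom (x-linear i) _ _ ⟫ ⊕-cong ≐-refl (x-comm i k _)))

  x-sum : ∀ i A B C D → x i (A ⊕ B ⊕ (C ⊕ D)) ≐ x i A ⊕ x i B ⊕ (x i C ⊕ x i D)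
  x-sum i A B C D = ⊕-hom x′ _ _ ⟫ ⊕-cong (⊕-hom x′ _ _) (⊕-hom x′ _ _)
    where x′ = x-linear i

  x-mixed : ∀ i A B C D → x i (A ⊖ B ⊖ C ⊕ D) ≐ x i A ⊖ x i B ⊖ x i C ⊕ x i D
  x-mixed i A B C D = ⊕-hom x′ _ _ ⟫ ⊕-cong (⊖-hom x′ _ _ ⟫ ⊖-cong (⊖-hom x′ _ _) ≐-refl) ≐-refl
    where x′ = x-linear i

  x-t-h : ∀ k q p i Φ → x k (t q (h (p , i) Φ)) ≐ x k (t q Φ) ⊕ x k (x i (t q (t p Φ)))
  x-t-h k q p i Φ = cong-≐ (x-linear k) (t-h q p i Φ) ⟫ ⊕-hom (x-linear k) _ _

  x-t-g : ∀ l q p i k Φ → x l (t q (g p i k Φ)) ≐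
    x l (t q Φ) ⊖ x l (x i (t q Φ)) ⊖ x l (x i (t q (t p Φ))) ⊕ x l (x k (t q (t p Φ)))
  x-t-g l q p i k Φ = cong-≐ (x-linear l) (t-g q p i k Φ) ⟫ x-mixed l _ _ _ _

  h-h : ∀ p q i k Φ → h (q , k) (h (p , i) Φ) ≐
    Φ ⊕ x i (t p Φ) ⊕ (x k (t q Φ) ⊕ x k (x i (t q (t p Φ))))
  h-h p q i k Φ = ⊕-cong (≐-refl {h (p , i) Φ}) (x-t-h k q p i Φ)

  t-h-h : ∀ p q i k Φ → t p (h (q , k) (h (p , i) Φ)) ≐
    t p Φ ⊖ x i (t p Φ) ⊕ (x k (t p (t q Φ)) ⊕ x k (x i (t p (t q (t p Φ)))))
  t-h-h p q i k Φ = t-h p q k (h (p , i) Φ) ⟫ ⊕-cong (t-h-idem p i Φ)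
    (cong-≐ (x-linear k)
      (cong-≐ (t-linear p) (t-h q p i Φ) ⟫ ⊕-hom (t-linear p) (t q Φ) (x i (t q (t p Φ))) ⟫
        ⊕-cong (≐-refl {t p (t q Φ)}) (t-x p i (t q (t p Φ)))) ⟫
      ⊕-hom (x-linear k) (t p (t q Φ)) (x i (t p (t q (t p Φ)))))

  t-g-idem : ∀ p i k (Φ : Series n m) → t p (g p i k Φ) ≐ t p Φ ⊖ x k (t p Φ)
  t-g-idem p i k Φ = t-g p p i k Φ ⟫
    ⊕-cong (⊖-cong ≐-refl (x-t-idem i p Φ)) (x-t-idem k p Φ) ⟫ t-g-ring _ _ _

  opaque
    unfolding _⊕_

    yang-baxter-ring : ∀ (A Xp Yq XYqp XA XXp XYq XYXqp XYpq XYXr Yp YXp YYpq XYYr Xq : Series n m) →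
      A ⊕ Xp ⊕ (Yq ⊕ XYqp)
        ⊖ (XA ⊕ XXp ⊕ (XYq ⊕ XYXqp))
        ⊖ (Xp ⊖ XXp ⊕ (XYpq ⊕ XYXr))
        ⊕ (Yp ⊖ YXp ⊕ (YYpq ⊕ XYYr)) ≐
      A ⊖ XA ⊖ Xq ⊕ Yq
        ⊕ (Yp ⊖ YXp ⊖ XYpq ⊕ YYpq)
        ⊕ ((Xq ⊖ XYq) ⊕ (XYqp ⊖ XYXqp ⊖ XYXr ⊕ XYYr))
    yang-baxter-ring A Xp Yq XYqp XA XXp XYq XYXqp XYpq XYXr Yp YXp YYpq XYYr Xq w α =
      ring (A w α) (Xp w α) (Yq w α) (XYqp w α) (XA w α) (XXp w α) (XYq w α) (XYXqp w α)
        (XYpq w α) (XYXr w α) (Yp w α) (YXp w α) (YYpq w α) (XYYr w α) (Xq w α)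
      where
      ring : ∀ A Xp Yq XYqp XA XXp XYq XYXqp XYpq XYXr Yp YXp YYpq XYYr Xq →
        A ℤ.+ Xp ℤ.+ (Yq ℤ.+ XYqp)
          ℤ.- (XA ℤ.+ XXp ℤ.+ (XYq ℤ.+ XYXqp))
          ℤ.- (Xp ℤ.- XXp ℤ.+ (XYpq ℤ.+ XYXr))
          ℤ.+ (Yp ℤ.- YXp ℤ.+ (YYpq ℤ.+ XYYr)) ≡
        A ℤ.- XA ℤ.- Xq ℤ.+ Yq
          ℤ.+ (Yp ℤ.- YXp ℤ.- XYpq ℤ.+ YYpq)
          ℤ.+ ((Xq ℤ.- XYq) ℤ.+ (XYqp ℤ.- XYXqp ℤ.- XYXr ℤ.+ XYYr))
      ring = solve-∀

  -- With a ⊕ b = a + b - ab and q = p + 1, this is h_p(a) h_q(a ⊕ b) h_p(b) = h_q(b) h_p(a ⊕ b)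
  -- h_q(a) for a = xᵢ and a ⊕ b = xₖ, multiplied by 1 - xᵢ. Both sides are expanded into words in
  -- Tₚ and T_q, after which a linear identity remains.
  yang-baxter : ∀ p i k Φ →
    g p i k (h (suc p , k) (h (p , i) Φ)) ≐ h (suc p , i) (h (p , k) (g (suc p) i k Φ))
  yang-baxter p i k Φ = lhs ⟫ yang-baxter-ring _ _ _ _ _ _ _ _ _ _ _ _ _ _ _ ⟫ ≐-sym rhs
    where
    q = suc p
    S = h (q , k) (h (p , i) Φ)
    Θ = g q i k Φ
    XY : Series n m → Series n m
    XY Ψ = x i (x k Ψ)
    pqp = t p (t q (t p Φ))
    xS : x i S ≐ x i Φ ⊕ x i (x i (t p Φ)) ⊕ (XY (t q Φ) ⊕ XY (x i (t q (t p Φ))))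
    xS = cong-≐ (x-linear i) (h-h p q i k Φ) ⟫ x-sum i _ _ _ _
    xtS : ∀ l → x l (t p S) ≐ x l (t p Φ) ⊖ x l (x i (t p Φ)) ⊕
      (x l (x k (t p (t q Φ))) ⊕ x l (x k (x i pqp)))
    xtS l = cong-≐ (x-linear l) (t-h-h p q i k Φ) ⟫ ⊕-hom (x-linear l) _ _ ⟫
      ⊕-cong (⊖-hom (x-linear l) _ _) (⊕-hom (x-linear l) _ _)
    YYX : x k (x k (x i pqp)) ≐ XY (x k pqp)
    YYX = cong-≐ (x-linear k) (x-comm k i pqp) ⟫ x-comm k i _
    lhs : g p i k S ≐
      Φ ⊕ x i (t p Φ) ⊕ (x k (t q Φ) ⊕ XY (t q (t p Φ)))
      ⊖ (x i Φ ⊕ x i (x i (t p Φ)) ⊕ (XY (t q Φ) ⊕ XY (x i (t q (t p Φ)))))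
      ⊖ (x i (t p Φ) ⊖ x i (x i (t p Φ)) ⊕ (XY (t p (t q Φ)) ⊕ XY (x i pqp)))
      ⊕ (x k (t p Φ) ⊖ x k (x i (t p Φ)) ⊕ (x k (x k (t p (t q Φ))) ⊕ XY (x k pqp)))
    lhs = ⊕-cong
      (⊖-cong
        (⊖-cong
          (h-h p q i k Φ ⟫ ⊕-cong (≐-refl {Φ ⊕ x i (t p Φ)})
            (⊕-cong (≐-refl {x k (t q Φ)}) (x-comm k i (t q (t p Φ)))))
          xS)
        (xtS i))
      (xtS k ⟫ ⊕-cong (≐-refl {x k (t p Φ) ⊖ x k (x i (t p Φ))})
        (⊕-cong (≐-refl {x k (x k (t p (t q Φ)))}) YYX))
    -- The only use of the braid relation: it matches the cubic terms of the two expansions.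
    braid : t q (t p (t q Φ)) ≐ pqp
    braid w α = sym (𝕋-braid p _ w)
    tqtpΘ : t q (t p Θ) ≐ t q (t p Φ) ⊖ x i (t q (t p Φ)) ⊖ x i pqp ⊕ x k pqp
    tqtpΘ = cong-≐ (t-linear q) (t-g p q i k Φ) ⟫
      ⊕-hom (t-linear q) (t p Φ ⊖ x i (t p Φ) ⊖ x i (t p (t q Φ))) (x k (t p (t q Φ))) ⟫ ⊕-cong
      (⊖-hom (t-linear q) (t p Φ ⊖ x i (t p Φ)) (x i (t p (t q Φ))) ⟫ ⊖-cong
        (⊖-hom (t-linear q) (t p Φ) (x i (t p Φ)) ⟫
          ⊖-cong (≐-refl {t q (t p Φ)}) (t-x q i (t p Φ)))
        (t-x q i (t p (t q Φ)) ⟫ cong-≐ (x-linear i) braid))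
      (t-x q k (t p (t q Φ)) ⟫ cong-≐ (x-linear k) braid)
    rhs : h (q , i) (h (p , k) Θ) ≐
      Θ ⊕ (x k (t p Φ) ⊖ x k (x i (t p Φ)) ⊖ XY (t p (t q Φ)) ⊕ x k (x k (t p (t q Φ))))
      ⊕ ((x i (t q Φ) ⊖ XY (t q Φ)) ⊕
         (XY (t q (t p Φ)) ⊖ XY (x i (t q (t p Φ))) ⊖ XY (x i pqp) ⊕ XY (x k pqp)))
    rhs = h-h p q k i Θ ⟫ ⊕-cong
      (⊕-cong (≐-refl {Θ}) (x-t-g k p q i k Φ ⟫ ⊕-cong
        (⊖-cong (≐-refl {x k (t p Φ) ⊖ x k (x i (t p Φ))}) (x-comm k i (t p (t q Φ))))
        (≐-refl {x k (x k (t p (t q Φ)))})))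
      (⊕-cong (cong-≐ (x-linear i) (t-g-idem q i k Φ) ⟫ ⊖-hom (x-linear i) (t q Φ) (x k (t q Φ)))
        (cong-≐ (x-linear i) (cong-≐ (x-linear k) tqtpΘ ⟫
            x-mixed k (t q (t p Φ)) (x i (t q (t p Φ))) (x i pqp) (x k pqp)) ⟫
          x-mixed i (x k (t q (t p Φ))) (x k (x i (t q (t p Φ)))) (x k (x i pqp)) (x k (x k pqp))))

-- The Fomin-Kirillov product

row : ℕ → ℕ → Fin n → List (ℕ × Fin n)
row p zero    i = []
row p (suc m) i = row (suc p) m i ++ (p , i) ∷ []

shift : ℕ × Fin n → ℕ × Fin (suc n)
shift (j , i) = suc j , suc i

rows : ∀ n → List (ℕ × Fin n)
rows zero    = []
rows (suc n) = row 0 n zero ++ List.map shift (rows n)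

row-shift : ∀ p m (i : Fin n) → List.map shift (row p m i) ≡ row (suc p) m (suc i)
row-shift p zero    i = refl
row-shift p (suc m) i = trans (List.map-++ shift (row (suc p) m i) _)
  (cong (_++ _) (row-shift (suc p) m i))

All-row : ∀ {P : ℕ × Fin n → Set} p m i → (∀ d → P (d ℕ.+ p , i)) → All P (row p m i)
All-row         p zero    i f = []
All-row {P = P} p (suc m) i f = All.++⁺
  (All-row (suc p) m i λ d → subst (λ l → P (l , i)) (sym (ℕ.+-suc d p)) (f (suc d)))
  (f 0 ∷ [])

map-row : ∀ (π : Fin n → Fin n) p m i → List.map (map₂ π) (row p m i) ≡ row p m (π i)
map-row π p zero    i = refl
map-row π p (suc m) i = trans (List.map-++ (map₂ π) (row (suc p) m i) _)
  (cong (_++ _) (map-row π (suc p) m i))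

-- The lowest letter h_p(xᵢ) of the first row commutes with all letters of the second row except
-- h_{p+1}(xₖ). Once the two are adjacent, Yang-Baxter turns `g p` behind them into `g (suc p)` in
-- front of them, where it meets two shorter rows.
two-rows : ∀ p m (i k : Fin n) (Φ : Series n n) →
  g p i k (run (row (suc p) m k) (run (row p (suc m) i) Φ)) ≐
  1-x i (run (row (suc p) m i) (run (row p (suc m) k) Φ))
two-rows p zero    i k Φ = h-g p i k Φ
two-rows {n} p (suc m) i k Φ =
  cong-≐ (g-linear p i k) (regroup i k) ⟫
  yang-baxter p i k _ ⟫
  cong-≐ hh (two-rows (suc p) m i k Φ) ⟫
  ≐-sym (1-x-hh _) ⟫
  ≐-sym (cong-≐ (1-x-linear i) (regroup k i))
  where
  hh : Linear (h (suc p , i) ∘ h (p , k))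
  hh = ∘-linear (h-linear (suc p , i)) (h-linear (p , k))
  1-x-hh : Commute (1-x i) (h (suc p , i) ∘ h (p , k))
  1-x-hh = ∘-commute {O = 1-x i} {P = h (suc p , i)} {Q = h (p , k)} (h-linear (suc p , i))
    (h-1-x i (suc p , i)) (h-1-x i (p , k))
  far : ∀ (i k : Fin _) d → Commute (h (p , i)) (h (d ℕ.+ suc (suc p) , k))
  far i k d = subst (λ l → Commute {n} {n} (h (p , i)) (h (l , k)))
    (sym (trans (ℕ.+-suc d (suc p)) (cong suc (ℕ.+-suc d p)))) (h-far p d i k)
  regroup : ∀ i k →
    run (row (suc p) (suc m) k) (run (row p (suc (suc m)) i) Φ) ≐
    h (suc p , k) (h (p , i) (run (row (suc (suc p)) m k) (run (row (suc p) (suc m) i) Φ)))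
  regroup i k
    rewrite run-++ (row (suc p) (suc m) i) ((p , i) ∷ []) Φ
          | run-++ (row (suc (suc p)) m k) ((suc p , k) ∷ []) (h (p , i) (run (row (suc p) (suc m) i) Φ))
    = cong-≐ (h-linear (suc p , k)) (≐-sym (run-commute (h-linear (p , i)) (row (suc (suc p)) m k)
        (All-row (suc (suc p)) m k (far i k)) _))

-- The exchange of variables must fix all factors outside the two rows, hence the conditions on
-- variables. Moreover `g` must pass through `after`, hence the distance of its letters from
-- `toℕ i`.
record Split {n} (i k : Fin n) : Set where
  field
    before after : List (ℕ × Fin n)
    len          : ℕ
    rows≡        : rows n ≡
      before ++ row (toℕ i) (suc len) i ++ row (suc (toℕ i)) len k ++ after
    before-vars  : All (λ l → proj₂ l ≢ i × proj₂ l ≢ k) before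
    after-vars   : All (λ l → proj₂ l ≢ i × proj₂ l ≢ k) after
    after-far    : All (λ l → ∃ λ d → proj₁ l ≡ 2 ℕ.+ d ℕ.+ toℕ i) after

≢-suc : ∀ {l i k : Fin n} → l ≢ i × l ≢ k → Fin.suc l ≢ suc i × Fin.suc l ≢ suc k
≢-suc (a , b) = a ∘ Fin.suc-injective , b ∘ Fin.suc-injective

split : ∀ (i k : Fin n) → toℕ k ≡ suc (toℕ i) → Split i k
split {suc (suc n)} zero (suc zero) refl = record
  { before = []
  ; after = List.map shift (List.map shift (rows n))
  ; len = n
  ; rows≡ = cong (row 0 (suc n) zero ++_)
      (trans (List.map-++ shift (row 0 n zero) (List.map shift (rows n)))
        (cong (_++ List.map shift (List.map shift (rows n))) (row-shift 0 n zero)))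
  ; before-vars = []
  ; after-vars = All.map⁺ (All.map⁺ (All.universal (λ _ → (λ ()) , λ ()) (rows n)))
  ; after-far = All.map⁺ (All.map⁺ (All.universal
      (λ l → proj₁ l , cong (2 ℕ.+_) (sym (ℕ.+-identityʳ _))) (rows n)))
  }
split {suc n} (suc i) (suc k) e = record
  { before = row 0 n zero ++ List.map shift S.before
  ; after = List.map shift S.after
  ; len = S.len
  ; rows≡ = trans (cong (row 0 n zero ++_) (trans (cong (List.map shift) S.rows≡)
      (trans (List.map-++ shift S.before _) (cong (List.map shift S.before ++_)
        (trans (List.map-++ shift (row (toℕ i) (suc S.len) i) _) (cong₂ _++_
          (row-shift (toℕ i) (suc S.len) i)
          (trans (List.map-++ shift (row (suc (toℕ i)) S.len k) _)
            (cong (_++ List.map shift S.after) (row-shift (suc (toℕ i)) S.len k)))))))))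
      (sym (List.++-assoc (row 0 n zero) (List.map shift S.before) _))
  ; before-vars = All.++⁺ (All-row 0 n zero λ _ → (λ ()) , λ ())
      (All.map⁺ (All.map ≢-suc S.before-vars))
  ; after-vars = All.map⁺ (All.map ≢-suc S.after-vars)
  ; after-far = All.map⁺ (All.map
      (λ { (d , e) → d , trans (cong suc e) (cong (2 ℕ.+_) (sym (ℕ.+-suc d (toℕ i)))) })
      S.after-far)
  }
  where module S = Split (split i k (ℕ.suc-injective e))

-- Exchange of two variables

transpose-ˡ : ∀ (i k : Fin n) → transpose i k i ≡ k
transpose-ˡ i k rewrite dec-true (i Fin.≟ i) refl = refl

transpose-ʳ : ∀ (i k : Fin n) → transpose i k k ≡ i
transpose-ʳ i k with k Fin.≟ i
... | yes k≡i = k≡i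
... | no _ rewrite dec-true (k Fin.≟ k) refl = refl

transpose-other : ∀ (i k : Fin n) {l} → l ≢ i → l ≢ k → transpose i k l ≡ l
transpose-other i k {l} l≢i l≢k
  rewrite dec-false (l Fin.≟ i) l≢i | dec-false (l Fin.≟ k) l≢k = refl

transpose-involutive : ∀ (i k : Fin n) l → transpose i k (transpose i k l) ≡ l
transpose-involutive i k l with l Fin.≟ i
... | yes refl = transpose-ʳ i k
... | no l≢i with l Fin.≟ k
...   | yes refl = transpose-ˡ i k
...   | no l≢k   = transpose-other i k l≢i l≢k

swapExponent : Fin n → Fin n → Vec ℕ n → Vec ℕ n
swapExponent i k α = tabulate (λ l → lookup α (transpose i k l))

lookup-injective : ∀ {A : Set} {α β : Vec A n} → (∀ l → lookup α l ≡ lookup β l) → α ≡ β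
lookup-injective {α = α} {β} e =
  trans (sym (Vec.tabulate∘lookup α)) (trans (Vec.tabulate-cong e) (Vec.tabulate∘lookup β))

lookup-swapExponent : ∀ (i k : Fin n) α l →
  lookup (swapExponent i k α) l ≡ lookup α (transpose i k l)
lookup-swapExponent i k α l = Vec.lookup∘tabulate _ l

swapExponent-inc : ∀ (i k l : Fin n) β →
  swapExponent i k (β [ l ]%= suc) ≡ swapExponent i k β [ transpose i k l ]%= suc
swapExponent-inc i k l β = lookup-injective λ q →
  trans (lookup-swapExponent i k (β [ l ]%= suc) q) (at q)
  where
  π = transpose i k
  at : ∀ q → lookup (β [ l ]%= suc) (π q) ≡ lookup (swapExponent i k β [ π l ]%= suc) q
  at q with q Fin.≟ π l
  ... | yes refl rewrite transpose-involutive i k l =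
    trans (Vec.lookup∘updateAt l {suc} β) (sym (trans (Vec.lookup∘updateAt (π l) {suc} (swapExponent i k β))
      (cong suc (trans (lookup-swapExponent i k β (π l)) (cong (lookup β) (transpose-involutive i k l))))))
  ... | no q≢πl = trans (Vec.lookup∘updateAt′ (π q) l πq≢l β)
    (sym (trans (Vec.lookup∘updateAt′ q (π l) q≢πl (swapExponent i k β)) (lookup-swapExponent i k β q)))
    where
    πq≢l : π q ≢ l
    πq≢l refl = q≢πl (sym (transpose-involutive i k q))

swapExponent-involutive : ∀ (i k : Fin n) α → swapExponent i k (swapExponent i k α) ≡ α
swapExponent-involutive i k α = lookup-injective λ q →
  trans (lookup-swapExponent i k (swapExponent i k α) q)
    (trans (lookup-swapExponent i k α (transpose i k q))
    (cong (lookup α) (transpose-involutive i k q)))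

X-zero : ∀ (i : Fin n) F α → lookup α i ≡ 0 → X i F α ≡ 0ℤ
X-zero zero    F (zero ∷ α) _ = refl
X-zero (suc i) F (c ∷ α)    e = X-zero i _ α e

X-swap : ∀ (i k l : Fin n) F α →
  X l F (swapExponent i k α) ≡ X (transpose i k l) (F ∘ swapExponent i k) α
X-swap i k l F α with X-view (transpose i k l) α
... | inj₁ (e , z) = trans
  (X-zero l F _ (trans (lookup-swapExponent i k α l) e)) (sym (z _))
... | inj₂ (β , refl) = trans (cong (X l F) (trans (swapExponent-inc i k _ β)
    (cong (λ q → swapExponent i k β [ q ]%= suc) (transpose-involutive i k l))))
  (trans (X-inc l F _) (sym (X-inc (transpose i k l) _ β)))

σ : Fin m → Fin m → Series n m → Series n m
σ i k Φ w α = Φ w (swapExponent i k α)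

opaque
  unfolding _⊕_

  σ-linear : ∀ (i k : Fin m) → Linear (σ {m} {n} i k)
  σ-linear i k .cong-≐ e w α  = e w _
  σ-linear i k .⊕-hom Φ Ψ w α = refl
  σ-linear i k .⊖-hom Φ Ψ w α = refl

σ-x : ∀ (i k l : Fin m) (Φ : Series n m) → σ i k (x l Φ) ≐ x (transpose i k l) (σ i k Φ)
σ-x i k l Φ w α = X-swap i k l (Φ w) α

σ-run : ∀ (i k : Fin m) r (Φ : Series n m) →
  σ i k (run r Φ) ≐ run (List.map (map₂ (transpose i k)) r) (σ i k Φ)
σ-run i k []            Φ = ≐-refl
σ-run i k ((j , l) ∷ r) Φ = σ-run i k r _ ⟫
  cong-≐ (run-linear (List.map (map₂ (transpose i k)) r))
    (⊕-hom (σ-linear i k) _ _ ⟫ ⊕-cong ≐-refl (σ-x i k l _))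

δ : Vec ℕ n → Series n m
δ u w α = if does (Vec.≡-dec ℕ._≟_ w u ×-dec Vec.≡-dec ℕ._≟_ α (replicate _ 0))
  then 1ℤ else 0ℤ

swapExponent-0 : ∀ (i k : Fin n) → swapExponent i k (replicate _ 0) ≡ replicate _ 0
swapExponent-0 i k = lookup-injective λ q → trans (lookup-swapExponent i k (replicate _ 0) q)
  (trans (Vec.lookup-replicate (transpose i k q) 0) (sym (Vec.lookup-replicate q 0)))

σ-δ : ∀ (i k : Fin m) (u : Vec ℕ n) → σ i k (δ u) ≐ δ u
σ-δ i k u w α
  with Vec.≡-dec ℕ._≟_ (swapExponent i k α) (replicate _ 0) | Vec.≡-dec ℕ._≟_ α (replicate _ 0)
... | yes _ | yes _ = refl
... | no _  | no _  = refl
... | yes e | no ne = ⊥-elim (ne (trans (sym (swapExponent-involutive i k α))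
                        (trans (cong (swapExponent i k) e) (swapExponent-0 i k))))
... | no ne | yes refl = ⊥-elim (ne (swapExponent-0 i k))

iota : ℕ → ∀ n → Vec ℕ n
iota b zero    = []
iota b (suc n) = b ∷ iota (suc b) n

FK : ∀ n → Series n n
FK n = run (rows n) (δ (iota 0 n))

map-other : ∀ (i k : Fin n) (r : List (ℕ × Fin n)) → All (λ l → proj₂ l ≢ i × proj₂ l ≢ k) r →
  List.map (map₂ (transpose i k)) r ≡ r
map-other i k []            []             = refl
map-other i k ((j , l) ∷ r) ((a , b) ∷ cs) =
  cong₂ _∷_ (cong (j ,_) (transpose-other i k a b)) (map-other i k r cs)

-- The divided difference recursion for all permutations at once, with denominators cleared. The
-- factors in front of and behind the two rows avoid both variables, so exchanging the rows'
-- variables is the same as applying `σ i k` to the whole product.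
FK-g : ∀ (i k : Fin n) → toℕ k ≡ suc (toℕ i) → g (toℕ i) i k (FK n) ≐ 1-x i (σ i k (FK n))
FK-g {n} i k e = subst (λ r → g p i k (run r D) ≐ 1-x i (σ i k (run r D))) (sym rows≡)
  (cong-≐ (g-linear p i k) (split-run i k) ⟫
   run-commute (g-linear p i k) after (All.map (λ {l} → far l) after-far) _ ⟫
   cong-≐ (run-linear after) (two-rows p len i k _) ⟫
   ≐-sym (run-commute (1-x-linear i) after (All.universal (h-1-x i) after) _) ⟫
   cong-≐ (1-x-linear i) (≐-sym (split-run k i) ⟫ ≐-sym swapped))
  where
  open Split (split i k e)
  p = toℕ i
  D = δ (iota 0 n)
  word : Fin n → Fin n → List (ℕ × Fin n)
  word i k = before ++ row p (suc len) i ++ row (suc p) len k ++ after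
  split-run : ∀ i k → run (word i k) D ≐
    run after (run (row (suc p) len k) (run (row p (suc len) i) (run before D)))
  split-run i k
    rewrite run-++ before (row p (suc len) i ++ row (suc p) len k ++ after) D
          | run-++ (row p (suc len) i) (row (suc p) len k ++ after) (run before D)
          | run-++ (row (suc p) len k) after (run (row p (suc len) i) (run before D))
    = ≐-refl
  far : ∀ l → (∃ λ d → proj₁ l ≡ 2 ℕ.+ d ℕ.+ p) → Commute (g p i k) (h l)
  far (_ , l) (d , refl) = g-far p i k d l
  π = map₂ {A = ℕ} {B = λ _ → Fin n} (transpose i k)
  swapped : σ i k (run (word i k) D) ≐ run (word k i) D
  swapped = σ-run i k (word i k) D ⟫
    cong-≐ (run-linear (List.map π (word i k))) (σ-δ i k _) ⟫
    λ w α → cong (λ r → run r D w α) (trans (List.map-++ π before _)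
      (cong₂ _++_ (map-other i k before before-vars)
        (trans (List.map-++ π (row p (suc len) i) _)
          (cong₂ _++_ (trans (map-row _ p (suc len) i) (cong (row p (suc len)) (transpose-ˡ i k)))
            (trans (List.map-++ π (row (suc p) len k) _)
              (cong₂ _++_ (trans (map-row _ (suc p) len k) (cong (row (suc p) len) (transpose-ʳ i k)))
                (map-other i k after after-vars)))))))

-- Divided differences

inc-injective : ∀ (i : Fin n) {α β : Vec ℕ n} → α [ i ]%= suc ≡ β [ i ]%= suc → α ≡ β
inc-injective zero    {a ∷ α} {b ∷ β} refl = refl
inc-injective (suc i) {a ∷ α} {b ∷ β} e    =
  cong₂ _∷_ (Vec.∷-injectiveˡ e) (inc-injective i (Vec.∷-injectiveʳ e))

lookup-inc : ∀ (i : Fin n) (α : Vec ℕ n) → lookup (α [ i ]%= suc) i ≡ suc (lookup α i)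
lookup-inc i α = Vec.lookup∘updateAt i {suc} α

-- Induction on the exponent of xₖ: the coefficient of the product at α + eᵢ
-- relates F at α to F at α + eᵢ - eₖ.
x-x-cancel : ∀ {i k : Fin n} → i ≢ k → ∀ (F H : Vec ℕ n → ℤ) →
  (∀ α → X i F α ℤ.- X k F α ≡ X i H α ℤ.- X k H α) → ∀ α → F α ≡ H α
x-x-cancel {i = i} {k} i≢k F H e α = go (lookup α k) α refl
  where
  at-inc : ∀ α → F α ℤ.- X k F (α [ i ]%= suc) ≡ H α ℤ.- X k H (α [ i ]%= suc)
  at-inc α = subst₂ (λ a b → a ℤ.- X k F α′ ≡ b ℤ.- X k H α′)
    (X-inc i F α) (X-inc i H α) (e α′)
    where α′ = α [ i ]%= suc
  cancel : ∀ {a b c d} → a ℤ.- c ≡ b ℤ.- d → c ≡ d → a ≡ b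
  cancel {a} {b} {c} p refl = trans (sym (ring a c)) (trans (cong (ℤ._+ c) p) (ring b c))
    where
    ring : ∀ a c → a ℤ.- c ℤ.+ c ≡ a
    ring = solve-∀
  go : ∀ c α → lookup α k ≡ c → F α ≡ H α
  go c α l with X-view k α
  ... | inj₁ (z , _) = cancel (at-inc α) (trans (X-zero k F _ z′) (sym (X-zero k H _ z′)))
    where z′ = trans (Vec.lookup∘updateAt′ k i (i≢k ∘ sym) α) z
  go zero    α l | inj₂ (β , refl) = ⊥-elim (ℕ.1+n≢0 (trans (sym (lookup-inc k β)) l))
  go (suc c) α l | inj₂ (β , refl) = cancel (at-inc α) (trans (at F) (trans
    (go c (β [ i ]%= suc) (trans (Vec.lookup∘updateAt′ k i (i≢k ∘ sym) β)
      (ℕ.suc-injective (trans (sym (lookup-inc k β)) l))))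
    (sym (at H))))
    where
    at : ∀ F → X k F (β [ k ]%= suc [ i ]%= suc) ≡ F (β [ i ]%= suc)
    at F = trans (cong (X k F) (Vec.updateAt-commutes i k i≢k β)) (X-inc k F _)

-- Coefficients of sums, products and exchanges

coeff-++ : ∀ (f g : Poly n) α → coeff (f ++ g) α ≡ coeff f α ℤ.+ coeff g α
coeff-++ []            g α = sym (ℤ.+-identityˡ _)
coeff-++ ((c , u) ∷ f) g α =
  trans (cong (λ a → term ℤ.+ a) (coeff-++ f g α)) (sym (ℤ.+-assoc term (coeff f α) (coeff g α)))
  where term = if does (Vec.≡-dec ℕ._≟_ u α) then c else 0ℤ

coeff-neg : ∀ (φ : ℤ × Vec ℕ n → ℤ × Vec ℕ n) → (∀ c u → φ (c , u) ≡ (ℤ.- c , u)) →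
  ∀ f α → coeff (List.map φ f) α ≡ ℤ.- coeff f α
coeff-neg φ e []            α = refl
coeff-neg φ e ((c , u) ∷ f) α rewrite e c u | coeff-neg φ e f α
  with does (Vec.≡-dec ℕ._≟_ u α)
... | true  = sym (ℤ.neg-distrib-+ c (coeff f α))
... | false = trans (ℤ.+-identityˡ (ℤ.- coeff f α)) (cong ℤ.-_ (sym (ℤ.+-identityˡ (coeff f α))))

coeff--ₚ : ∀ (f g : Poly n) α → coeff (f -ₚ g) α ≡ coeff f α ℤ.- coeff g α
coeff--ₚ f g α = trans (coeff-++ f _ α) (cong (λ a → coeff f α ℤ.+ a) (coeff-neg _ (λ _ _ → refl) g α))

-- The map is a parameter known through its values, so that the lemma applies to the anonymous
-- function inside `_*ₚ_`, with `c` equal to 1 or -1.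
coeff-x : ∀ c (j : Fin n) (φ : ℤ × Vec ℕ n → ℤ × Vec ℕ n) →
  (∀ d u → φ (d , u) ≡ (c ℤ.* d , u [ j ]%= suc)) →
  ∀ f α → coeff (List.map φ f) α ≡ c ℤ.* X j (coeff f) α
coeff-x c j φ e f α with X-view j α
... | inj₁ (l , z) = trans (go f) (sym (trans (cong (c ℤ.*_) (z _)) (ℤ.*-zeroʳ c)))
  where
  go : ∀ f → coeff (List.map φ f) α ≡ 0ℤ
  go []            = refl
  go ((d , u) ∷ f) rewrite e d u | go f
    with Vec.≡-dec ℕ._≟_ (u [ j ]%= suc) α
  ... | yes refl = ⊥-elim (ℕ.1+n≢0 (trans (sym (lookup-inc j u)) l))
  ... | no _     = refl
... | inj₂ (β , refl) = trans (go f) (cong (c ℤ.*_) (sym (X-inc j _ β)))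
  where
  go : ∀ f → coeff (List.map φ f) (β [ j ]%= suc) ≡ c ℤ.* coeff f β
  go []            = sym (ℤ.*-zeroʳ c)
  go ((d , u) ∷ f) rewrite e d u | go f
    with Vec.≡-dec ℕ._≟_ (u [ j ]%= suc) (β [ j ]%= suc) | Vec.≡-dec ℕ._≟_ u β
  ... | yes _ | yes _ = sym (ℤ.*-distribˡ-+ c d (coeff f β))
  ... | no _  | no _  = trans (ℤ.+-identityˡ _) (cong (c ℤ.*_) (sym (ℤ.+-identityˡ _)))
  ... | yes p | no q  = ⊥-elim (q (inc-injective j p))
  ... | no q  | yes refl = ⊥-elim (q refl)

x-times : ∀ (j : Fin n) u → Vec.zipWith ℕ._+_ (replicate n 0 [ j ]%= suc) u ≡ u [ j ]%= suc
x-times zero    (a ∷ u) = cong (suc a ∷_) (Vec.zipWith-identityˡ ℕ.+-identityˡ u)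
x-times (suc j) (a ∷ u) = cong (a ∷_) (x-times j u)

coeff-x*ₚ : ∀ (j : Fin n) f α → coeff (Defs.x j *ₚ f) α ≡ X j (coeff f) α
coeff-x*ₚ j f α = trans (coeff-++ (List.map _ f) [] α) (trans (ℤ.+-identityʳ _)
  (trans (coeff-x 1ℤ j _ (λ d u → cong (1ℤ ℤ.* d ,_) (x-times j u)) f α) (ℤ.*-identityˡ _)))

coeff-x-x*ₚ : ∀ (j k : Fin n) f α →
  coeff ((Defs.x j -ₚ Defs.x k) *ₚ f) α ≡ X j (coeff f) α ℤ.- X k (coeff f) α
coeff-x-x*ₚ j k f α = trans (coeff-++ (List.map _ f) _ α) (cong₂ ℤ._+_
  (trans (coeff-x 1ℤ j _ (λ d u → cong (1ℤ ℤ.* d ,_) (x-times j u)) f α) (ℤ.*-identityˡ _))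
  (trans (coeff-++ (List.map _ f) [] α) (trans (ℤ.+-identityʳ _)
    (trans (coeff-x ℤ.-1ℤ k _ (λ d u → cong (ℤ.-1ℤ ℤ.* d ,_) (x-times k u)) f α)
      (ℤ.-1*i≡-i _)))))

coeff-swap : ∀ (j k : Fin n) f α → coeff (swapVars j k f) α ≡ coeff f (swapExponent j k α)
coeff-swap j k []            α = refl
coeff-swap j k ((c , u) ∷ f) α rewrite coeff-swap j k f α
  with Vec.≡-dec ℕ._≟_ (swapExponent j k u) α | Vec.≡-dec ℕ._≟_ u (swapExponent j k α)
... | yes _    | yes _    = refl
... | no _     | no _     = refl
... | yes refl | no q     = ⊥-elim (q (sym (swapExponent-involutive j k u)))
... | no q     | yes refl = ⊥-elim (q (swapExponent-involutive j k α))

word : Permutation′ n → Vec ℕ n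
word w = tabulate (λ i → toℕ (w ⟨$⟩ʳ i))

descent-tabulate : ∀ (i k : Fin n) (e f : Fin n → ℕ) → toℕ k ≡ suc (toℕ i) →
  e i < e k → f i ≡ e k → f k ≡ e i → (∀ l → l ≢ i → l ≢ k → f l ≡ e l) →
  Descent (toℕ i) (tabulate f) (tabulate e)
descent-tabulate zero (suc zero) e f refl lt fi fk fl
  rewrite fi | fk | Vec.tabulate-cong (λ l → fl (suc (suc l)) (λ ()) (λ ())) = here lt
descent-tabulate (suc i) (suc k) e f p lt fi fk fl rewrite fl zero (λ ()) (λ ()) =
  there (descent-tabulate i k (e ∘ suc) (f ∘ suc) (ℕ.suc-injective p) lt fi fk
    (λ l a b → fl (suc l) (a ∘ Fin.suc-injective) (b ∘ Fin.suc-injective)))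

word-ascent : ∀ (w : Permutation′ n) (i k : Fin n) → toℕ k ≡ suc (toℕ i) →
  toℕ (w ⟨$⟩ʳ i) < toℕ (w ⟨$⟩ʳ k) →
  Descent (toℕ i) (word (Permutation.transpose i k ∘ₚ w)) (word w)
word-ascent w i k e lt = descent-tabulate i k (λ l → toℕ (w ⟨$⟩ʳ l)) _ e lt
  (cong v (transpose-ˡ i k)) (cong v (transpose-ʳ i k))
  (λ l a b → cong v (transpose-other i k a b))
  where v = λ l → toℕ (w ⟨$⟩ʳ l)

opaque
  unfolding _⊕_

  -- The coefficient of `FK-g` at `w`. By the descent, Tᵢ contributes `FK n w′` - `FK n w`, so the
  -- terms xᵢ `FK n w` cancel; and (1 - xᵢ) times the exchanged `FK n w` is the exchange of (1 - xₖ)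
  -- `FK n w`.
  FK-∂̄ : ∀ (i k : Fin n) {w w′} → toℕ k ≡ suc (toℕ i) → Descent (toℕ i) w w′ → ∀ α →
    X i (FK n w′) α ℤ.- X k (FK n w′) α ≡
    (FK n w α ℤ.- X k (FK n w) α) ℤ.-
    (FK n w (swapExponent i k α) ℤ.- X k (FK n w) (swapExponent i k α))
  FK-∂̄ {n} i k {w} {w′} e d α
    rewrite trans (X-swap i k k (FK n w) α)
      (cong (λ l → X l (FK n w ∘ swapExponent i k) α) (transpose-ʳ i k)) =
    rearrange (FK n w α) (X i (FK n w) α) (X i (FK n w′) α) (X k (FK n w) α) (X k (FK n w′) α)
      (subst₂ (λ a b → FK n w α ℤ.- X i (FK n w) α ℤ.- a ℤ.+ b ≡ _)
        (xt i) (xt k) (FK-g i k e w α))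
    where
    xt : ∀ l → x l (t (toℕ i) (FK n)) w α ≡ X l (FK n w′) α ℤ.- X l (FK n w) α
    xt l = trans (cong-≐ (x-linear l) {Φ = λ _ → t (toℕ i) (FK n) w}
        {Ψ = λ _ β → FK n w′ β ℤ.- FK n w β} (λ _ β → 𝕋-descent d (λ u → FK n u β)) w α)
      (⊖-hom (x-linear l) (λ _ → FK n w′) (λ _ → FK n w) w α)
    rearrange : ∀ G XG XG′ YG YG′ {S} → G ℤ.- XG ℤ.- (XG′ ℤ.- XG) ℤ.+ (YG′ ℤ.- YG) ≡ S →
      XG′ ℤ.- YG′ ≡ (G ℤ.- YG) ℤ.- S
    rearrange G XG XG′ YG YG′ refl = ring G XG XG′ YG YG′
      where
      ring : ∀ G XG XG′ YG YG′ → XG′ ℤ.- YG′ ≡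
        (G ℤ.- YG) ℤ.- (G ℤ.- XG ℤ.- (XG′ ℤ.- XG) ℤ.+ (YG′ ℤ.- YG))
      ring = solve-∀

-- Positivity and pipe dreams

smaller : ℕ → Vec ℕ n → ℕ
smaller a = Vec.count (ℕ._<? a)

inversions : Vec ℕ n → ℕ
inversions []      = 0
inversions (a ∷ w) = smaller a w ℕ.+ inversions w

smaller-< : ∀ {a b} (w : Vec ℕ n) → b < a → smaller a (b ∷ w) ≡ suc (smaller a w)
smaller-< {a = a} {b} w b<a rewrite dec-true (b ℕ.<? a) b<a = refl

smaller-≮ : ∀ {a b} (w : Vec ℕ n) → ¬ b < a → smaller a (b ∷ w) ≡ smaller a w
smaller-≮ {a = a} {b} w b≮a rewrite dec-false (b ℕ.<? a) b≮a = refl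

smaller-swap : ∀ c a b (w : Vec ℕ n) → smaller c (a ∷ b ∷ w) ≡ smaller c (b ∷ a ∷ w)
smaller-swap c a b w with does (a ℕ.<? c) | does (b ℕ.<? c)
... | true  | true  = refl
... | true  | false = refl
... | false | true  = refl
... | false | false = refl

smaller-tail : ∀ c a (w w′ : Vec ℕ n) → smaller c w ≡ smaller c w′ →
  smaller c (a ∷ w) ≡ smaller c (a ∷ w′)
smaller-tail c a w w′ e with does (a ℕ.<? c)
... | true  = cong suc e
... | false = e

smaller-descent : ∀ c {j} {w w′ : Vec ℕ n} → Descent j w w′ → smaller c w ≡ smaller c w′
smaller-descent c (here {a = a} {b} {w} _)       = smaller-swap c a b w
smaller-descent c (there {a = a} {w} {w′} d) = smaller-tail c a w w′ (smaller-descent c d)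

inversions-descent : ∀ {j} {w w′ : Vec ℕ n} → Descent j w w′ →
  inversions w ≡ suc (inversions w′)
inversions-descent (here {a = a} {b} {w} b<a)
  rewrite smaller-< w b<a | smaller-≮ w (ℕ.<-asym b<a) =
  cong suc (trans (sym (ℕ.+-assoc (smaller a w) (smaller b w) _)) (trans
    (cong (ℕ._+ inversions w) (ℕ.+-comm (smaller a w) (smaller b w)))
    (ℕ.+-assoc (smaller b w) (smaller a w) _)))
inversions-descent (there {a = a} {w} {w′} d)
  rewrite smaller-descent a d | inversions-descent d = ℕ.+-suc (smaller a w′) _

smaller-iota : ∀ a b n → a ≤ b → smaller a (iota b n) ≡ 0
smaller-iota a b zero    a≤b = refl
smaller-iota a b (suc n) a≤b =
  trans (smaller-≮ (iota (suc b) n) (ℕ.≤⇒≯ a≤b)) (smaller-iota a (suc b) n (ℕ.m≤n⇒m≤1+n a≤b))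

inversions-iota : ∀ b n → inversions (iota b n) ≡ 0
inversions-iota b zero    = refl
inversions-iota b (suc n) =
  cong₂ ℕ._+_ (smaller-iota b (suc b) n (ℕ.n≤1+n b)) (inversions-iota (suc b) n)

h-descent : ∀ {j} {w w′ : Vec ℕ n} → Descent j w w′ → ∀ i (Φ : Series n m) β →
  h (j , i) Φ w (β [ i ]%= suc) ≡ Φ w (β [ i ]%= suc) ℤ.+ (Φ w′ β ℤ.- Φ w β)
h-descent {w = w} d i Φ β = trans (⊕-at Φ _ w _) (cong (λ a → Φ w (β [ i ]%= suc) ℤ.+ a)
  (trans (X-inc i _ β) (𝕋-descent d _)))

h-view : ∀ j i (Φ : Series n m) w α → (h (j , i) Φ w α ≡ Φ w α) ⊎
  (∃ λ w′ → ∃ λ β → Descent j w w′ × α ≡ β [ i ]%= suc)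
h-view j i Φ w α with X-view i α | 𝕋-view j w
... | inj₁ (_ , z)    | _ = inj₁ (trans (⊕-at Φ _ w α)
  (trans (cong (λ a → Φ w α ℤ.+ a) (z _)) (ℤ.+-identityʳ _)))
... | inj₂ (β , refl) | inj₂ z = inj₁ (trans (⊕-at Φ _ w α)
  (trans (cong (λ a → Φ w α ℤ.+ a) (trans (X-inc i _ β) (z _))) (ℤ.+-identityʳ _)))
... | inj₂ (β , refl) | inj₁ (w′ , d , _) = inj₂ (w′ , β , d , refl)

-- The coefficient at the longest permutation

Supported : ℕ → Series n m → Set
Supported k Φ = ∀ w α → k < inversions w → Φ w α ≡ 0ℤ

h-supported : ∀ {k} l (Φ : Series n m) → Supported k Φ → Supported (suc k) (h l Φ)
h-supported {k = k} (j , i) Φ s w α lt with h-view j i Φ w α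
... | inj₁ e = trans e (s w α (ℕ.<-trans (ℕ.n<1+n k) lt))
... | inj₂ (w′ , β , d , refl) = trans (h-descent d i Φ β)
  (cong₂ ℤ._+_ (s w _ k<w) (cong₂ ℤ._-_ (s w′ β k<w′) (s w β k<w)))
  where
  k<w = ℕ.<-trans (ℕ.n<1+n k) lt
  k<w′ = ℕ.≤-pred (subst (suc k <_) (inversions-descent d) lt)

mono : Vec ℕ m → Vec ℕ m → ℤ
mono β α = if does (Vec.≡-dec ℕ._≟_ β α) then 1ℤ else 0ℤ

X-mono : ∀ (i : Fin m) β α → X i (mono β) α ≡ mono (β [ i ]%= suc) α
X-mono i β α with X-view i α
... | inj₁ (l , z) rewrite z (mono β) with Vec.≡-dec ℕ._≟_ (β [ i ]%= suc) α
...   | yes refl = ⊥-elim (ℕ.1+n≢0 (trans (sym (lookup-inc i β)) l))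
...   | no _     = refl
X-mono i β α | inj₂ (γ , refl) rewrite X-inc i (mono β) γ
  with Vec.≡-dec ℕ._≟_ β γ | Vec.≡-dec ℕ._≟_ (β [ i ]%= suc) (γ [ i ]%= suc)
... | yes _    | yes _ = refl
... | no _     | no _  = refl
... | yes refl | no q  = ⊥-elim (q refl)
... | no q     | yes p = ⊥-elim (q (inc-injective i p))

-- Every letter of the list is used and creates an inversion.  The exponents
-- record the variables that have been met.
data Ascends {m n} : List (ℕ × Fin m) → Vec ℕ n → Vec ℕ m → Vec ℕ n → Vec ℕ m → Set where
  done : ∀ {z β} → Ascends [] z β z β
  up   : ∀ {j i r z z₁ w β α} → Descent j z₁ z → Ascends r z₁ (β [ i ]%= suc) w α →
         Ascends ((j , i) ∷ r) z β w α

-- A letter adds at most one inversion, and along `Ascends` it adds exactly one. So the words met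
-- always have the largest possible number of inversions; skipping or absorbing a letter cannot lead
-- to them, and a single monomial survives.
ascends-run : ∀ {r} {z w : Vec ℕ n} {β α : Vec ℕ m} → Ascends r z β w α → ∀ (Φ : Series n m) →
  Supported (inversions z) Φ → (∀ γ → Φ z γ ≡ mono β γ) → ∀ γ → run r Φ w γ ≡ mono α γ
ascends-run done Φ s e = e
ascends-run (up {j} {i} {z = z} {z₁} {β = β} d a) Φ s e =
  ascends-run a (h (j , i) Φ)
    (subst (λ k → Supported k (h (j , i) Φ)) (sym (inversions-descent d)) (h-supported (j , i) Φ s))
    λ γ → trans (⊕-at Φ _ z₁ γ) (trans (cong₂ ℤ._+_ (z₁≡0 γ)
      (trans (cong-≐ (x-linear i) {Φ = λ _ → t j Φ z₁} {Ψ = λ _ → mono β} (λ _ → at) z γ)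
        (X-mono i β γ))) (ℤ.+-identityˡ _))
  where
  z₁≡0 : ∀ γ → Φ z₁ γ ≡ 0ℤ
  z₁≡0 γ = s z₁ γ (subst (inversions z <_) (sym (inversions-descent d)) (ℕ.n<1+n _))
  at : ∀ γ → t j Φ z₁ γ ≡ mono β γ
  at γ = trans (𝕋-descent d _) (trans (cong (λ a → Φ z γ ℤ.- a) (z₁≡0 γ))
    (trans (ℤ.+-identityʳ _) (e γ)))

ascends-++ : ∀ {r s} {z y w : Vec ℕ n} {γ β α : Vec ℕ m} →
  Ascends r z γ y β → Ascends s y β w α → Ascends (r ++ s) z γ w α
ascends-++ done     b = b
ascends-++ (up d a) b = up d (ascends-++ a b)

ascends-tail : ∀ {r} {z w : Vec ℕ n} {β α : Vec ℕ m} a → Ascends r z β w α →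
  Ascends (List.map (map₁ suc) r) (a ∷ z) β (a ∷ w) α
ascends-tail a done     = done
ascends-tail a (up d b) = up (there d) (ascends-tail a b)

ascends-shift : ∀ {r} {z w : Vec ℕ n} {β α : Vec ℕ m} a c → Ascends r z β w α →
  Ascends (List.map shift r) (a ∷ z) (c ∷ β) (a ∷ w) (c ∷ α)
ascends-shift a c done     = done
ascends-shift a c (up d b) = up (there d) (ascends-shift a c b)

row-suc : ∀ p m (i : Fin n) → List.map (map₁ suc) (row p m i) ≡ row (suc p) m i
row-suc p zero    i = refl
row-suc p (suc m) i = trans (List.map-++ (map₁ suc) (row (suc p) m i) _)
  (cong (_++ (suc p , i) ∷ []) (row-suc (suc p) m i))

-- Using every letter of the row carries the last and largest entry to the front, with one crossing
-- per letter.
ascends-row : ∀ {b c} {γ : Vec ℕ m} (z : Vec ℕ n) → VAll (_< b) z →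
  Ascends (row 0 n zero) (z ∷ʳ b) (c ∷ γ) (b ∷ z) (c ℕ.+ n ∷ γ)
ascends-row {c = c} {γ} [] [] rewrite ℕ.+-identityʳ c = done
ascends-row {n = suc n} {b} {c} {γ} (a ∷ z) (a<b ∷ z<b) =
  subst (λ r → Ascends (r ++ (0 , zero) ∷ []) (a ∷ (z ∷ʳ b)) (c ∷ γ) (b ∷ a ∷ z) (c ℕ.+ suc n ∷ γ))
    (row-suc 0 n zero) (ascends-++ (ascends-tail a (ascends-row z z<b))
      (subst (λ c′ → Ascends ((0 , zero) ∷ []) (a ∷ b ∷ z) (c ℕ.+ n ∷ γ) (b ∷ a ∷ z) (c′ ∷ γ))
        (sym (ℕ.+-suc c n)) (up (here a<b) done)))

iota-∷ʳ : ∀ b n → iota b (suc n) ≡ iota b n ∷ʳ (b ℕ.+ n)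
iota-∷ʳ b zero    = cong (_∷ []) (sym (ℕ.+-identityʳ b))
iota-∷ʳ b (suc n) = cong (b ∷_) (trans (iota-∷ʳ (suc b) n)
  (cong (iota (suc b) n ∷ʳ_) (sym (ℕ.+-suc b n))))

iota-< : ∀ b n → VAll (_< b ℕ.+ n) (iota b n)
iota-< b zero    = []
iota-< b (suc n) rewrite ℕ.+-suc b n = s≤s (ℕ.m≤m+n b n) ∷ iota-< (suc b) n

-- The one-line word of the longest permutation is the staircase itself.
ascends-rows : ∀ n → Ascends (rows n) (iota 0 n) (replicate n 0) staircase staircase
ascends-rows zero    = done
ascends-rows (suc n) = ascends-++
  (subst (λ z → Ascends (row 0 n zero) z (replicate (suc n) 0) (n ∷ iota 0 n) (n ∷ replicate n 0))
    (sym (iota-∷ʳ 0 n)) (ascends-row (iota 0 n) (iota-< 0 n)))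
  (ascends-shift n n (ascends-rows n))

δ-supported : Supported {n} {m} 0 (δ (iota 0 n))
δ-supported {n} w α lt with Vec.≡-dec ℕ._≟_ w (iota 0 n)
... | yes refl = ⊥-elim (ℕ.n≮0 (subst (0 <_) (inversions-iota 0 n) lt))
... | no _     = refl

δ-start : ∀ (u : Vec ℕ n) (γ : Vec ℕ m) → δ u u γ ≡ mono (replicate m 0) γ
δ-start u γ rewrite dec-true (Vec.≡-dec ℕ._≟_ u u) refl
  with Vec.≡-dec ℕ._≟_ γ (replicate _ 0) | Vec.≡-dec ℕ._≟_ (replicate _ 0) γ
... | yes _    | yes _ = refl
... | no _     | no _  = refl
... | yes refl | no q  = ⊥-elim (q refl)
... | no q     | yes p = ⊥-elim (q (sym p))

FK-longest : ∀ n γ → FK n staircase γ ≡ mono staircase γ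
FK-longest n = ascends-run (ascends-rows n) _
  (subst (λ k → Supported {n} {n} k (δ (iota 0 n))) (sym (inversions-iota 0 n)) δ-supported)
  (δ-start (iota 0 n))

-- Any choice of ascents leads to the same result: the product satisfies the recursion at each of
-- them, and `x-x-cancel` makes the quotient by xᵢ - xₖ unique.
grothendieck-coeff : ∀ {w : Permutation′ n} {f} → IsGrothendieck w f →
  ∀ α → coeff f α ≡ FK n (word w) α
grothendieck-coeff {n} {w} {f} (longest w≈ f≈) α = trans (f≈ α) (trans (ℤ.+-identityʳ _)
  (trans (sym (FK-longest n α)) (cong (λ u → FK n u α) (sym w≡))))
  where
  w≡ : word w ≡ staircase
  w≡ = Vec.tabulate-cong λ i → trans (cong toℕ (w≈ i)) (Fin.opposite-prop i)
grothendieck-coeff {n} {w} {f} (ascent i k e lt f′ isG is∂̄) =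
  x-x-cancel i≢k (coeff f) (FK n (word w)) λ α →
    trans (sym (coeff-x-x*ₚ i k f α)) (trans (is∂̄ α) (trans (coeff--ₚ F (swapVars i k F) α)
      (trans (cong₂ ℤ._-_ (F-coeff α) (trans (coeff-swap i k F α) (F-coeff (swapExponent i k α))))
        (sym (FK-∂̄ i k e (word-ascent w i k e lt) α)))))
  where
  i≢k : i ≢ k
  i≢k refl = ℕ.1+n≢n (sym e)
  F = f′ -ₚ Defs.x k *ₚ f′
  w′ = word (Permutation.transpose i k ∘ₚ w)
  IH : ∀ α → coeff f′ α ≡ FK n w′ α
  IH = grothendieck-coeff isG
  F-coeff : ∀ α → coeff F α ≡ FK n w′ α ℤ.- X k (FK n w′) α
  F-coeff α = trans (coeff--ₚ f′ _ α) (cong₂ ℤ._-_ (IH α) (trans (coeff-x*ₚ k f′ α)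
    (cong-≐ (x-linear k) {Φ = λ _ → coeff f′} {Ψ = λ _ → FK n w′} (λ _ → IH) w′ α)))

-- Signs of the coefficients

sgn : ℕ → ℤ
sgn zero    = 1ℤ
sgn (suc k) = ℤ.- sgn k

-- A used letter raises the degree by one. A crossing also raises the inversions and contributes
-- with sign +, an absorbed letter keeps them and contributes with sign -. So the sign is the parity
-- of degree minus inversions; the sum has the same parity and avoids subtraction.
unsigned : Series n m → Series n m
unsigned Φ w α = sgn (inversions w ℕ.+ Vec.sum α) ℤ.* Φ w α

sum-inc : ∀ (i : Fin m) α → Vec.sum (α [ i ]%= suc) ≡ suc (Vec.sum α)
sum-inc zero    (a ∷ α) = refl
sum-inc (suc i) (a ∷ α) = trans (cong (a ℕ.+_) (sum-inc i α)) (ℕ.+-suc a _)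

unsigned-h : ∀ {j} {w w′ : Vec ℕ n} → Descent j w w′ → ∀ i (Φ : Series n m) β →
  unsigned (h (j , i) Φ) w (β [ i ]%= suc) ≡
  unsigned Φ w (β [ i ]%= suc) ℤ.+ (unsigned Φ w′ β ℤ.+ unsigned Φ w β)
unsigned-h {w = w} {w′} d i Φ β
  rewrite h-descent d i Φ β | sum-inc i β | inversions-descent d
        | ℕ.+-suc (inversions w′) (Vec.sum β) =
  ring (sgn (inversions w′ ℕ.+ Vec.sum β)) (Φ w (β [ i ]%= suc)) (Φ w′ β) (Φ w β)
  where
  ring : ∀ s a b c → ℤ.- (ℤ.- s) ℤ.* (a ℤ.+ (b ℤ.- c)) ≡
    ℤ.- (ℤ.- s) ℤ.* a ℤ.+ (s ℤ.* b ℤ.+ ℤ.- s ℤ.* c)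
  ring = solve-∀

NonNegative : Series n m → Set
NonNegative Φ = ∀ w α → 0ℤ ℤ.≤ unsigned Φ w α

h-nonNegative : ∀ l (Φ : Series n m) → NonNegative Φ → NonNegative (h l Φ)
h-nonNegative (j , i) Φ p w α with h-view j i Φ w α
... | inj₁ e rewrite e = p w α
... | inj₂ (w′ , β , d , refl) rewrite unsigned-h d i Φ β =
  ℤ.+-mono-≤ (p w _) (ℤ.+-mono-≤ (p w′ β) (p w β))

-- One letter of a pipe dream: the crossing either creates an inversion or is
-- absorbed by an existing one.
data Step : ∀ {n} → ℕ → Vec ℕ n → Vec ℕ n → Set where
  cross  : ∀ {a b} {w : Vec ℕ n} → a < b → Step 0 (a ∷ b ∷ w) (b ∷ a ∷ w)
  absorb : ∀ {a b} {w : Vec ℕ n} → b < a → Step 0 (a ∷ b ∷ w) (a ∷ b ∷ w)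
  there  : ∀ {j a} {w w′ : Vec ℕ n} → Step j w w′ → Step (suc j) (a ∷ w) (a ∷ w′)

step-descent : ∀ {j} {z z′ : Vec ℕ n} → Step j z z′ →
  Descent j z′ z ⊎ (z ≡ z′ × ∃ λ y → Descent j z y)
step-descent (cross p)  = inj₁ (here p)
step-descent (absorb p) = inj₂ (refl , _ , here p)
step-descent (there s) with step-descent s
... | inj₁ d              = inj₁ (there d)
... | inj₂ (refl , _ , d) = inj₂ (refl , _ , there d)

-- Reach r z β w α: some subword of r leads from z to w by Demazure products,
-- its variables contributing the difference of the exponents α and β.
data Reach {m n} : List (ℕ × Fin m) → Vec ℕ n → Vec ℕ m → Vec ℕ n → Vec ℕ m → Set where
  done : ∀ {z β} → Reach [] z β z β
  skip : ∀ {l r z w β α} → Reach r z β w α → Reach (l ∷ r) z β w α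
  use  : ∀ {j i r z z′ w β α} → Step j z z′ → Reach r z′ (β [ i ]%= suc) w α →
         Reach ((j , i) ∷ r) z β w α

h-skip-pos : ∀ l (Φ : Series n m) → NonNegative Φ → ∀ w α → 0ℤ ℤ.< unsigned Φ w α →
  0ℤ ℤ.< unsigned (h l Φ) w α
h-skip-pos (j , i) Φ p w α lt with h-view j i Φ w α
... | inj₁ e rewrite e = lt
... | inj₂ (w′ , β , d , refl) rewrite unsigned-h d i Φ β =
  ℤ.+-mono-<-≤ lt (ℤ.+-mono-≤ (p w′ β) (p w β))

h-use-pos : ∀ {j} i (Φ : Series n m) → NonNegative Φ → ∀ {z z′ β} → Step j z z′ →
  0ℤ ℤ.< unsigned Φ z β → 0ℤ ℤ.< unsigned (h (j , i) Φ) z′ (β [ i ]%= suc)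
h-use-pos i Φ p {z} {z′} {β} s lt with step-descent s
... | inj₁ d rewrite unsigned-h d i Φ β =
  ℤ.+-mono-≤-< (p z′ _) (ℤ.+-mono-<-≤ lt (p z′ β))
... | inj₂ (refl , y , d) rewrite unsigned-h d i Φ β =
  ℤ.+-mono-≤-< (p z _) (ℤ.+-mono-≤-< (p y β) lt)

reach-pos : ∀ {r} {z w : Vec ℕ n} {β α : Vec ℕ m} → Reach r z β w α → ∀ Φ → NonNegative Φ →
  0ℤ ℤ.< unsigned Φ z β → 0ℤ ℤ.< unsigned (run r Φ) w α
reach-pos done      Φ p lt = lt
reach-pos (skip {l = l} {z = z} {β = β} q) Φ p lt =
  reach-pos q _ (h-nonNegative l Φ p) (h-skip-pos l Φ p z β lt)
reach-pos (use {j} {i} s q) Φ p lt =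
  reach-pos q _ (h-nonNegative (j , i) Φ p) (h-use-pos i Φ p s lt)

sum-replicate-0 : ∀ n → Vec.sum (replicate n 0) ≡ 0
sum-replicate-0 zero    = refl
sum-replicate-0 (suc n) = sum-replicate-0 n

unsigned-start : unsigned {n} {m} (δ (iota 0 n)) (iota 0 n) (replicate m 0) ≡ 1ℤ
unsigned-start {n} {m}
  rewrite inversions-iota 0 n | sum-replicate-0 m
        | dec-true (Vec.≡-dec ℕ._≟_ (iota 0 n) (iota 0 n)) refl
        | dec-true (Vec.≡-dec ℕ._≟_ (replicate m 0) (replicate m 0)) refl = refl

δ-nonNegative : NonNegative {n} {m} (δ (iota 0 n))
δ-nonNegative {n} {m} w α
  with Vec.≡-dec ℕ._≟_ w (iota 0 n) | Vec.≡-dec ℕ._≟_ α (replicate _ 0)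
... | yes refl | yes refl
    rewrite inversions-iota 0 n | sum-replicate-0 m = ℤ.+≤+ z≤n
... | yes _    | no _ rewrite ℤ.*-zeroʳ (sgn (inversions w ℕ.+ Vec.sum α)) = ℤ.≤-refl
... | no _     | _    rewrite ℤ.*-zeroʳ (sgn (inversions w ℕ.+ Vec.sum α)) = ℤ.≤-refl

reach-nonzero : ∀ {w α} → Reach (rows n) (iota 0 n) (replicate n 0) w α → FK n w α ≢ 0ℤ
reach-nonzero {n} {w} {α} q e = ℤ.<-irrefl (sym (trans
  (cong (λ a → sgn (inversions w ℕ.+ Vec.sum α) ℤ.* a) e) (ℤ.*-zeroʳ (sgn (inversions w ℕ.+ Vec.sum α)))))
  (reach-pos q (δ (iota 0 n)) δ-nonNegative
    (subst (0ℤ ℤ.<_) (sym (unsigned-start {n} {n})) (ℤ.+<+ (s≤s z≤n))))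

-- Codes and left multiplication

-- best a ps is the length of the longest increasing sequence of entries larger
-- than a, if ps pairs each entry x with best x of the entries after it.
best : ℕ → Vec (ℕ × ℕ) n → ℕ
best a []             = 0
best a ((x , r) ∷ ps) = (if a <ᵇ x then suc r else 0) ⊔ best a ps

ranked : Vec ℕ n → Vec (ℕ × ℕ) n
ranked []      = []
ranked (a ∷ w) = (a , best a (ranked w)) ∷ ranked w

ranks : Vec ℕ n → Vec ℕ n
ranks w = map proj₂ (ranked w)

complement : Vec ℕ n → Vec ℕ n
complement []               = []
complement {suc n} (r ∷ rs) = (n ∸ r) ∷ complement rs

raj-code : Vec ℕ n → Vec ℕ n
raj-code w = complement (ranks w)

-- Because the largest admissible index is raised first, each L_w(i) consists of an initial part
-- equal to the inversion code, at most one intermediate entry, and a maximal rest. The last two are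
-- covered by `top`, the first by `low`.
data Fam : ∀ {n} → Vec ℕ n → Vec ℕ n → Set where
  []  : Fam [] []
  low : ∀ {a} {w α : Vec ℕ n} → Fam w α → Fam (a ∷ w) (smaller a w ∷ α)
  top : ∀ {a c} {w : Vec ℕ n} → smaller a w ≤ c → c ≤ n ∸ best a (ranked w) →
        Fam (a ∷ w) (c ∷ raj-code w)

<ᵇ-cong : ∀ {a b c d} → (a < b → c < d) → (c < d → a < b) → (a <ᵇ b) ≡ (c <ᵇ d)
<ᵇ-cong {a} {b} {c} {d} f g with a <ᵇ b in p | c <ᵇ d in q
... | true  | true  = refl
... | false | false = refl
... | true  | false = ⊥-elim (ℕ.<⇒≱ (f (<ᵇ≡true⇒< a b p)) (<ᵇ≡false⇒≥ c d q))
... | false | true  = ⊥-elim (ℕ.<⇒≱ (g (<ᵇ≡true⇒< c d q)) (<ᵇ≡false⇒≥ a b p))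

best-map : ∀ (f : ℕ → ℕ) a b (ps : Vec (ℕ × ℕ) n) →
  VAll (λ p → (b <ᵇ f (proj₁ p)) ≡ (a <ᵇ proj₁ p)) ps → best b (map (map₁ f) ps) ≡ best a ps
best-map f a b []             []       = refl
best-map f a b ((x , r) ∷ ps) (e ∷ es) rewrite e | best-map f a b ps es = refl

All-ranked : ∀ {P : ℕ → Set} {w : Vec ℕ n} → VAll P w → VAll (P ∘ proj₁) (ranked w)
All-ranked []       = []
All-ranked (p ∷ ps) = p ∷ All-ranked ps

-- Ranks depend only on the relative order of the entries. The predicate allows relabellings that
-- keep the order on part of ℕ only, such as `swapValue i` on the values other than `suc i`.
ranked-map : ∀ {P : ℕ → Set} (f : ℕ → ℕ) → (∀ {x y} → P x → P y → (f x <ᵇ f y) ≡ (x <ᵇ y)) →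
  ∀ {w : Vec ℕ n} → VAll P w → ranked (map f w) ≡ map (map₁ f) (ranked w)
ranked-map f m {[]}    []       = refl
ranked-map f m {a ∷ w} (p ∷ ps) rewrite ranked-map f m ps =
  cong (λ r → (f a , r) ∷ map (map₁ f) (ranked w))
    (best-map f a (f a) (ranked w) (VAll.map (m p) (All-ranked ps)))

map-proj₂-map₁ : ∀ (f : ℕ → ℕ) (ps : Vec (ℕ × ℕ) n) → map proj₂ (map (map₁ f) ps) ≡ map proj₂ ps
map-proj₂-map₁ f ps = sym (Vec.map-∘ proj₂ (map₁ f) ps)

best-≥ : ∀ {a y s} {ps : Vec (ℕ × ℕ) n} → (y , s) ∈ ps → a < y → suc s ≤ best a ps
best-≥ {a = a} {ps = (_ , s) ∷ ps} (here refl) a<y rewrite <⇒<ᵇ≡true a<y =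
  ℕ.m≤m⊔n (suc s) (best a ps)
best-≥ (there p)   a<y = ℕ.≤-trans (best-≥ p a<y) (ℕ.m≤n⊔m _ _)

best-≤ : ∀ {a k} (ps : Vec (ℕ × ℕ) n) → (∀ {y s} → (y , s) ∈ ps → a < y → suc s ≤ k) → best a ps ≤ k
best-≤ []                     f = z≤n
best-≤ {a = a} ((x , r) ∷ ps) f with a <ᵇ x in e
... | true  = ℕ.⊔-lub (f (here refl) (<ᵇ≡true⇒< a x e)) (best-≤ ps (f ∘ there))
... | false = best-≤ ps (f ∘ there)

∈-map⁻ : ∀ {A B : Set} (f : A → B) {y} {xs : Vec A n} → y ∈ map f xs → ∃ λ x → x ∈ xs × y ≡ f x
∈-map⁻ f {xs = x ∷ xs} (here refl) = x , here refl , refl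
∈-map⁻ f {xs = x ∷ xs} (there p) with ∈-map⁻ f p
... | y , q , e = y , there q , e

∈-ranked⁻ : ∀ {y s} {w : Vec ℕ n} → (y , s) ∈ ranked w → y ∈ w
∈-ranked⁻ {w = a ∷ w} (here refl) = here refl
∈-ranked⁻ {w = a ∷ w} (there p)   = there (∈-ranked⁻ p)

∈-ranked⁺ : ∀ {y} {w : Vec ℕ n} → y ∈ w → ∃ λ s → (y , s) ∈ ranked w
∈-ranked⁺ (here refl) = _ , here refl
∈-ranked⁺ (there p) with ∈-ranked⁺ p
... | s , q = s , there q

All-∈ : ∀ {P : ℕ → Set} {y} {w : Vec ℕ n} → VAll P w → y ∈ w → P y
All-∈ (p ∷ ps) (here refl) = p
All-∈ (p ∷ ps) (there q)   = All-∈ ps q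

ranked-functional : ∀ {y r s} {w : Vec ℕ n} → Unique w → (y , r) ∈ ranked w → (y , s) ∈ ranked w → r ≡ s
ranked-functional {w = a ∷ w} (a∉ ∷ u) (here refl) (here refl) = refl
ranked-functional {w = a ∷ w} (a∉ ∷ u) (here refl) (there q)   = ⊥-elim (All-∈ a∉ (∈-ranked⁻ q) refl)
ranked-functional {w = a ∷ w} (a∉ ∷ u) (there p)   (here refl) = ⊥-elim (All-∈ a∉ (∈-ranked⁻ p) refl)
ranked-functional {w = a ∷ w} (a∉ ∷ u) (there p)   (there q)   = ranked-functional u p q

unique-map : ∀ {P : ℕ → Set} (f : ℕ → ℕ) → (∀ {x y} → P x → P y → f x ≡ f y → x ≡ y) →
  ∀ {w : Vec ℕ n} → VAll P w → Unique w → Unique (map f w)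
unique-map f inj []       []        = []
unique-map f inj (p ∷ ps) (a∉ ∷ u) =
  VAllₚ.map⁺ (VAll.map (λ (q , ne) e → ne (inj p q e)) (VAll.zip (ps , a∉))) ∷ unique-map f inj ps u

swapValue : ℕ → ℕ → ℕ
swapValue i x = if does (x ℕ.≟ i) then suc i else (if does (x ℕ.≟ suc i) then i else x)

swapValue-i : ∀ i → swapValue i i ≡ suc i
swapValue-i i rewrite dec-true (i ℕ.≟ i) refl = refl

swapValue-suc : ∀ i → swapValue i (suc i) ≡ i
swapValue-suc i rewrite dec-false (suc i ℕ.≟ i) ℕ.1+n≢n | dec-true (i ℕ.≟ i) refl = refl

swapValue-other : ∀ {i x} → x ≢ i → x ≢ suc i → swapValue i x ≡ x
swapValue-other {i} {x} p q rewrite dec-false (x ℕ.≟ i) p | dec-false (x ℕ.≟ suc i) q = refl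

data SwapView (i : ℕ) : ℕ → ℕ → Set where
  is-i   : SwapView i i (suc i)
  is-suc : SwapView i (suc i) i
  other  : ∀ {x} → x ≢ i → x ≢ suc i → SwapView i x x

swapView : ∀ i x → SwapView i x (swapValue i x)
swapView i x with x ℕ.≟ i
... | yes refl rewrite swapValue-i i = is-i
... | no p with x ℕ.≟ suc i
...   | yes refl rewrite swapValue-suc i = is-suc
...   | no q rewrite swapValue-other p q = other p q

swapValue-involutive : ∀ i x → swapValue i (swapValue i x) ≡ x
swapValue-involutive i x with swapValue i x | swapView i x
... | _ | is-i      = swapValue-suc i
... | _ | is-suc    = swapValue-i i
... | _ | other p q = swapValue-other p q

swapValue-injective : ∀ i {x y} → swapValue i x ≡ swapValue i y → x ≡ y
swapValue-injective i {x} {y} e = trans (sym (swapValue-involutive i x))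
  (trans (cong (swapValue i) e) (swapValue-involutive i y))

swapValue-< : ∀ {i k x} → suc i < k → x < k → swapValue i x < k
swapValue-< {i} {k} {x} lt x<k with swapValue i x | swapView i x
... | _ | is-i      = lt
... | _ | is-suc    = ℕ.<-trans (ℕ.n<1+n i) lt
... | _ | other p q = x<k

-- The exchange reverses the order of the pair i, i + 1 only, so it is monotone as soon as one of
-- the two values is missing.
swapValue-mono-≢i : ∀ {i x y} → x ≢ i → y ≢ i → x < y → swapValue i x < swapValue i y
swapValue-mono-≢i {i} {x} {y} p q lt
  with swapValue i x | swapView i x | swapValue i y | swapView i y
... | _ | is-i      | _ | _         = ⊥-elim (p refl)
... | _ | _         | _ | is-i      = ⊥-elim (q refl)
... | _ | is-suc    | _ | is-suc    = ⊥-elim (ℕ.<-irrefl refl lt)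
... | _ | is-suc    | _ | other _ _ = ℕ.<-trans (ℕ.n<1+n i) lt
... | _ | other _ _ | _ | is-suc    = ℕ.≤∧≢⇒< (ℕ.≤-pred lt) p
... | _ | other _ _ | _ | other _ _ = lt

swapValue-mono-≢suc : ∀ {i x y} → x ≢ suc i → y ≢ suc i → x < y → swapValue i x < swapValue i y
swapValue-mono-≢suc {i} {x} {y} p q lt
  with swapValue i x | swapView i x | swapValue i y | swapView i y
... | _ | is-suc    | _ | _         = ⊥-elim (p refl)
... | _ | _         | _ | is-suc    = ⊥-elim (q refl)
... | _ | is-i      | _ | is-i      = ⊥-elim (ℕ.<-irrefl refl lt)
... | _ | is-i      | _ | other _ _ = ℕ.≤∧≢⇒< lt (q ∘ sym)
... | _ | other _ _ | _ | is-i      = ℕ.m≤n⇒m≤1+n lt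
... | _ | other _ _ | _ | other _ _ = lt

swapValue-reflect-≢suc : ∀ {i x y} → x ≢ suc i → y ≢ suc i →
  (swapValue i x <ᵇ swapValue i y) ≡ (x <ᵇ y)
swapValue-reflect-≢suc {i} {x} {y} p q = <ᵇ-cong back (swapValue-mono-≢suc p q)
  where
  back : swapValue i x < swapValue i y → x < y
  back lt with ℕ.<-cmp x y
  ... | tri< x<y _ _  = x<y
  ... | tri≈ _ refl _ = ⊥-elim (ℕ.<-irrefl refl lt)
  ... | tri> _ _ y<x  = ⊥-elim (ℕ.<-asym lt (swapValue-mono-≢suc q p y<x))

map-swapValue-id : ∀ {i} {w : Vec ℕ n} → VAll (_≢ i) w → VAll (_≢ suc i) w → map (swapValue i) w ≡ w
map-swapValue-id []       []       = refl
map-swapValue-id (p ∷ ps) (q ∷ qs) = cong₂ _∷_ (swapValue-other p q) (map-swapValue-id ps qs)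

map-swapValue-involutive : ∀ i (w : Vec ℕ n) → map (swapValue i) (map (swapValue i) w) ≡ w
map-swapValue-involutive i w = trans (sym (Vec.map-∘ _ _ w))
  (trans (Vec.map-cong (swapValue-involutive i) w) (Vec.map-id w))

-- Left Demazure multiplication by sᵢ.
leftMul : ℕ → Vec ℕ n → Vec ℕ n
leftMul i []      = []
leftMul i (a ∷ w) =
  if does (a ℕ.≟ i) then map (swapValue i) (a ∷ w) else
  (if does (a ℕ.≟ suc i) then a ∷ w else a ∷ leftMul i w)

leftMul-i : ∀ i (w : Vec ℕ n) → leftMul i (i ∷ w) ≡ suc i ∷ map (swapValue i) w
leftMul-i i w rewrite dec-true (i ℕ.≟ i) refl = refl

leftMul-suc : ∀ i (w : Vec ℕ n) → leftMul i (suc i ∷ w) ≡ suc i ∷ w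
leftMul-suc i w rewrite dec-false (suc i ℕ.≟ i) ℕ.1+n≢n | dec-true (i ℕ.≟ i) refl = refl

leftMul-other : ∀ {i a} → a ≢ i → a ≢ suc i → (w : Vec ℕ n) → leftMul i (a ∷ w) ≡ a ∷ leftMul i w
leftMul-other {i = i} {a} p q w rewrite dec-false (a ℕ.≟ i) p | dec-false (a ℕ.≟ suc i) q = refl

step-map : ∀ {P : ℕ → Set} (f : ℕ → ℕ) → (∀ {x y} → P x → P y → x < y → f x < f y) →
  ∀ {j} {w w′ : Vec ℕ n} → VAll P w → Step j w w′ → Step j (map f w) (map f w′)
step-map f m (p ∷ q ∷ _) (cross lt)  = cross (m p q lt)
step-map f m (p ∷ q ∷ _) (absorb lt) = absorb (m q p lt)
step-map f m (_ ∷ ps)    (there s)   = there (step-map f m ps s)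

step-All : ∀ {P : ℕ → Set} {j} {w w′ : Vec ℕ n} → Step j w w′ → VAll P w → VAll P w′
step-All (cross _)  (p ∷ q ∷ ps) = q ∷ p ∷ ps
step-All (absorb _) ps           = ps
step-All (there s)  (p ∷ ps)     = p ∷ step-All s ps

step-unique : ∀ {j} {w w′ : Vec ℕ n} → Step j w w′ → Unique w → Unique w′
step-unique (cross _)  ((p ∷ ps) ∷ qs ∷ u) = ((p ∘ sym) ∷ qs) ∷ ps ∷ u
step-unique (absorb _) u                   = u
step-unique (there s)  (ps ∷ u)            = step-All s ps ∷ step-unique s u

data ValueView (i : ℕ) : ℕ → Set where
  is-i   : ValueView i i
  is-suc : ValueView i (suc i)
  other  : ∀ {x} → x ≢ i → x ≢ suc i → ValueView i x

valueView : ∀ i x → ValueView i x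
valueView i x with x ℕ.≟ i
... | yes refl = is-i
... | no p with x ℕ.≟ suc i
...   | yes refl = is-suc
...   | no q     = other p q

-- Left and right Demazure multiplication commute. A step changes its kind only when it crosses i
-- with i + 1: after the left multiplication this pair is already inverted, and the letter is
-- absorbed.
step-leftMul : ∀ i {j} {z z′ : Vec ℕ n} → Unique z → Step j z z′ → Step j (leftMul i z) (leftMul i z′)
step-leftMul i ((_ ∷ a∉) ∷ b∉ ∷ u) (cross {a = a} {b} {w} lt) with valueView i a | valueView i b
... | is-i | is-i = ⊥-elim (ℕ.<-irrefl refl lt)
... | is-i | is-suc
    rewrite leftMul-i i (suc i ∷ w) | leftMul-suc i (i ∷ w) | swapValue-suc i
          | map-swapValue-id (VAll.map (_∘ sym) a∉) (VAll.map (_∘ sym) b∉) = absorb (ℕ.n<1+n i)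
... | is-i | other p q
    rewrite leftMul-i i (b ∷ w) | leftMul-other p q (i ∷ w) | leftMul-i i w | swapValue-other p q =
    cross (ℕ.≤∧≢⇒< lt (q ∘ sym))
... | is-suc | is-i = ⊥-elim (ℕ.<-asym lt (ℕ.n<1+n i))
... | is-suc | is-suc = ⊥-elim (ℕ.<-irrefl refl lt)
... | is-suc | other p q
    rewrite leftMul-suc i (b ∷ w) | leftMul-other p q (suc i ∷ w) | leftMul-suc i w = cross lt
... | other p q | is-i
    rewrite leftMul-other p q (i ∷ w) | leftMul-i i w | leftMul-i i (a ∷ w) | swapValue-other p q =
    cross (ℕ.m≤n⇒m≤1+n lt)
... | other p q | is-suc
    rewrite leftMul-other p q (suc i ∷ w) | leftMul-suc i w | leftMul-suc i (a ∷ w) = cross lt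
... | other p q | other p′ q′
    rewrite leftMul-other p q (b ∷ w) | leftMul-other p′ q′ w | leftMul-other p′ q′ (a ∷ w)
          | leftMul-other p q w = cross lt
step-leftMul i u (absorb {a = a} {b} {w} lt) with valueView i a | valueView i b
... | is-i | is-i = ⊥-elim (ℕ.<-irrefl refl lt)
... | is-i | is-suc = ⊥-elim (ℕ.<-asym lt (ℕ.n<1+n i))
... | is-i | other p q
    rewrite leftMul-i i (b ∷ w) | swapValue-other p q = absorb (ℕ.m≤n⇒m≤1+n lt)
... | is-suc | _ rewrite leftMul-suc i (b ∷ w) = absorb lt
... | other p q | is-i
    rewrite leftMul-other p q (i ∷ w) | leftMul-i i w = absorb (ℕ.≤∧≢⇒< lt (q ∘ sym))
... | other p q | is-suc
    rewrite leftMul-other p q (suc i ∷ w) | leftMul-suc i w = absorb lt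
... | other p q | other p′ q′
    rewrite leftMul-other p q (b ∷ w) | leftMul-other p′ q′ w = absorb lt
step-leftMul i (a∉ ∷ u) (there {a = a} {w} {w′} s) with valueView i a
... | is-i rewrite leftMul-i i w | leftMul-i i w′ =
    there (step-map (swapValue i) swapValue-mono-≢i (VAll.map (_∘ sym) a∉) s)
... | is-suc rewrite leftMul-suc i w | leftMul-suc i w′ = there s
... | other p q rewrite leftMul-other p q w | leftMul-other p q w′ = there (step-leftMul i u s)

reach-leftMul : ∀ i {r : List (ℕ × Fin m)} {z w : Vec ℕ n} {β α} → Unique z → Reach r z β w α →
  Reach r (leftMul i z) β (leftMul i w) α
reach-leftMul i u done      = done
reach-leftMul i u (skip q)  = skip (reach-leftMul i u q)
reach-leftMul i u (use s q) = use (step-leftMul i u s) (reach-leftMul i (step-unique s u) q)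

reach-shift : ∀ {r : List (ℕ × Fin m)} {z w : Vec ℕ n} {β α} c → Reach r z β w α →
  Reach (List.map shift r) (0 ∷ map suc z) (c ∷ β) (0 ∷ map suc w) (c ∷ α)
reach-shift c done      = done
reach-shift c (skip q)  = skip (reach-shift c q)
reach-shift {z = z} c (use s q) = use
  (there (step-map {P = λ _ → ⊤} suc (λ _ _ → s≤s) (VAll.universal (λ _ → tt) z) s)) (reach-shift c q)

-- Flattening of words and permutations

punchIn punchOut : ℕ → ℕ → ℕ
punchIn  a x = if x <ᵇ a then x else suc x
punchOut a x = if x <ᵇ a then x else pred x

punchIn-< : ∀ {a x} → x < a → punchIn a x ≡ x
punchIn-< lt rewrite <⇒<ᵇ≡true lt = refl

punchIn-≥ : ∀ {a x} → a ≤ x → punchIn a x ≡ suc x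
punchIn-≥ le rewrite ≮⇒<ᵇ≡false (ℕ.≤⇒≯ le) = refl

punchIn-punchOut : ∀ {a x} → x ≢ a → punchIn a (punchOut a x) ≡ x
punchIn-punchOut {a} {x} ne with x <ᵇ a in e
... | true  = punchIn-< (<ᵇ≡true⇒< x a e)
... | false with ℕ.≤∧≢⇒< (<ᵇ≡false⇒≥ x a e) (ne ∘ sym)
...   | s≤s a≤x = punchIn-≥ a≤x

punchOut-< : ∀ {a x k} → x ≢ a → a < suc k → x < suc k → punchOut a x < k
punchOut-< {a} {x} ne a<k x<k with x <ᵇ a in e
... | true  = ℕ.<-≤-trans (<ᵇ≡true⇒< x a e) (ℕ.≤-pred a<k)
... | false with ℕ.≤∧≢⇒< (<ᵇ≡false⇒≥ x a e) (ne ∘ sym)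
...   | s≤s a≤x = ℕ.≤-pred x<k

punchIn-mono : ∀ a {x y} → x < y → punchIn a x < punchIn a y
punchIn-mono a {x} {y} lt with x <ᵇ a in p | y <ᵇ a in q
... | true  | true  = lt
... | true  | false = ℕ.m≤n⇒m≤1+n lt
... | false | true  = ⊥-elim (ℕ.<⇒≱ (ℕ.<-trans lt (<ᵇ≡true⇒< y a q)) (<ᵇ≡false⇒≥ x a p))
... | false | false = s≤s lt

punchIn-reflect : ∀ a {x y} → (punchIn a x <ᵇ punchIn a y) ≡ (x <ᵇ y)
punchIn-reflect a {x} {y} = <ᵇ-cong back (punchIn-mono a)
  where
  back : punchIn a x < punchIn a y → x < y
  back lt with ℕ.<-cmp x y
  ... | tri< x<y _ _  = x<y
  ... | tri≈ _ refl _ = ⊥-elim (ℕ.<-irrefl refl lt)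
  ... | tri> _ _ y<x  = ⊥-elim (ℕ.<-asym lt (punchIn-mono a y<x))

punchOut-injective : ∀ {a x y} → x ≢ a → y ≢ a → punchOut a x ≡ punchOut a y → x ≡ y
punchOut-injective {a} p q e =
  trans (sym (punchIn-punchOut p)) (trans (cong (punchIn a) e) (punchIn-punchOut q))

map-punchIn-punchOut : ∀ {a} {w : Vec ℕ n} → VAll (a ≢_) w → map (punchIn a) (map (punchOut a) w) ≡ w
map-punchIn-punchOut []       = refl
map-punchIn-punchOut (p ∷ ps) = cong₂ _∷_ (punchIn-punchOut (p ∘ sym)) (map-punchIn-punchOut ps)

IsPerm : Vec ℕ n → Set
IsPerm {n} w = Unique w × VAll (_< n) w

perm-tail : ∀ {a} {w : Vec ℕ n} → IsPerm (a ∷ w) → IsPerm (map (punchOut a) w)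
perm-tail (a∉ ∷ u , a<n ∷ w<n) =
  unique-map _ (λ p q → punchOut-injective (p ∘ sym) (q ∘ sym)) a∉ u ,
  VAllₚ.map⁺ (VAll.map (λ (p , lt) → punchOut-< (p ∘ sym) a<n lt) (VAll.zip (a∉ , w<n)))

-- The pigeonhole principle, by induction on the flattened tail.
perm-∈ : ∀ {w : Vec ℕ n} → IsPerm w → ∀ {y} → y < n → y ∈ w
perm-∈ {w = a ∷ w} π@(a∉ ∷ u , a<n ∷ w<n) {y} lt with y ℕ.≟ a
... | yes refl = here refl
... | no y≢a with ∈-map⁻ (punchOut a) (perm-∈ (perm-tail π) (punchOut-< y≢a a<n lt))
...   | x , x∈w , e =
  there (subst (_∈ w) (sym (punchOut-injective y≢a (All-∈ a∉ x∈w ∘ sym) e)) x∈w)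

smaller-map : ∀ {f : ℕ → ℕ} {a b} → (∀ x → (f x <ᵇ b) ≡ (x <ᵇ a)) →
  ∀ (w : Vec ℕ n) → smaller b (map f w) ≡ smaller a w
smaller-map         e []      = refl
smaller-map {a = a} e (x ∷ w) rewrite e x with x <ᵇ a
... | true  = cong suc (smaller-map e w)
... | false = smaller-map e w

smaller-perm : ∀ {w : Vec ℕ n} → IsPerm w → ∀ {a} → a ≤ n → smaller a w ≡ a
smaller-perm {w = []} π z≤n = refl
smaller-perm {suc n} {w = b ∷ w} π@(b∉ ∷ u , b<n ∷ w<n) {a} a≤n with ℕ.<-≤-connex b a
... | inj₂ a≤b = trans (smaller-≮ w (ℕ.≤⇒≯ a≤b)) (trans (cong (smaller a) (sym (map-punchIn-punchOut b∉)))
  (trans (smaller-map below (map (punchOut b) w)) (smaller-perm (perm-tail π) (ℕ.≤-trans a≤b (ℕ.≤-pred b<n)))))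
  where
  below : ∀ x → (punchIn b x <ᵇ a) ≡ (x <ᵇ a)
  below x with ℕ.<-≤-connex x b
  ... | inj₁ x<b rewrite punchIn-< x<b = refl
  ... | inj₂ b≤x rewrite punchIn-≥ b≤x = <ᵇ-cong ℕ.<⇒≤
    (λ x<a → ⊥-elim (ℕ.<⇒≱ x<a (ℕ.≤-trans a≤b b≤x)))
... | inj₁ (s≤s {n = a′} b≤a′) = trans (smaller-< w (s≤s b≤a′)) (cong suc
  (trans (cong (smaller (suc a′)) (sym (map-punchIn-punchOut b∉)))
    (trans (smaller-map above (map (punchOut b) w)) (smaller-perm (perm-tail π) (ℕ.≤-pred a≤n)))))
  where
  above : ∀ x → (punchIn b x <ᵇ suc a′) ≡ (x <ᵇ a′)
  above x with ℕ.<-≤-connex x b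
  ... | inj₁ x<b rewrite punchIn-< x<b = <ᵇ-cong (λ _ → ℕ.<-≤-trans x<b b≤a′) ℕ.m≤n⇒m≤1+n
  ... | inj₂ b≤x rewrite punchIn-≥ b≤x = refl

smaller-head : ∀ {a} {w : Vec ℕ n} → IsPerm (a ∷ w) → smaller a w ≡ a
smaller-head {a = a} {w} π@(_ , a<n ∷ _) =
  trans (sym (smaller-≮ w (ℕ.<-irrefl refl))) (smaller-perm π (ℕ.<⇒≤ a<n))

ranked-punchIn : ∀ a (v : Vec ℕ n) → ranked (map (punchIn a) v) ≡ map (map₁ (punchIn a)) (ranked v)
ranked-punchIn a v = ranked-map {P = λ _ → ⊤} (punchIn a) (λ _ _ → punchIn-reflect a) (VAll.universal (λ _ → tt) v)

ranks-punchIn : ∀ a (v : Vec ℕ n) → ranks (map (punchIn a) v) ≡ ranks v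
ranks-punchIn a v = trans (cong (map proj₂) (ranked-punchIn a v)) (map-proj₂-map₁ (punchIn a) (ranked v))

fam-punchIn : ∀ a {v : Vec ℕ n} {α} → Fam (map (punchIn a) v) α → Fam v α
fam-punchIn a {[]}    []      = []
fam-punchIn a {b ∷ v} {_ ∷ α} (low f) = subst (λ c → Fam (b ∷ v) (c ∷ α))
  (sym (smaller-map (λ x → punchIn-reflect a) v)) (low (fam-punchIn a f))
fam-punchIn a {b ∷ v} {c ∷ _} (top lo hi) = subst (λ β → Fam (b ∷ v) (c ∷ β))
  (cong complement (sym (ranks-punchIn a v)))
  (top (subst (_≤ c) (smaller-map (λ x → punchIn-reflect a) v) lo)
    (subst (λ k → c ≤ _ ∸ k) best≡ hi))
  where
  best≡ : best (punchIn a b) (ranked (map (punchIn a) v)) ≡ best b (ranked v)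
  best≡ = trans (cong (best (punchIn a b)) (ranked-punchIn a v))
    (best-map (punchIn a) b (punchIn a b) (ranked v) (VAll.universal (λ _ → punchIn-reflect a) (ranked v)))

smaller-mono : ∀ {a b} → a ≤ b → ∀ (w : Vec ℕ n) → smaller a w ≤ smaller b w
smaller-mono a≤b []      = z≤n
smaller-mono {a = a} {b} a≤b (x ∷ w) with x <ᵇ a in p | x <ᵇ b in q
... | true  | true  = s≤s (smaller-mono a≤b w)
... | false | true  = ℕ.m≤n⇒m≤1+n (smaller-mono a≤b w)
... | false | false = smaller-mono a≤b w
... | true  | false = ⊥-elim (ℕ.<⇒≱ (ℕ.<-≤-trans (<ᵇ≡true⇒< x a p) a≤b) (<ᵇ≡false⇒≥ x b q))

-- An increasing sequence above `a` and the entries below `a` have no entry in common. This is the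
-- inequality between inversion code and raj code.
best+smaller : ∀ a (w : Vec ℕ n) → best a (ranked w) ℕ.+ smaller a w ≤ n
best+smaller a []      = z≤n
best+smaller {suc n} a (x ∷ w) with ℕ.<-cmp a x
... | tri< a<x _ _
    rewrite <⇒<ᵇ≡true a<x | smaller-≮ w (ℕ.<-asym a<x)
          | ℕ.+-distribʳ-⊔ (smaller a w) (suc (best x (ranked w))) (best a (ranked w)) =
    ℕ.⊔-lub (s≤s (ℕ.≤-trans (ℕ.+-monoʳ-≤ (best x (ranked w)) (smaller-mono (ℕ.<⇒≤ a<x) w))
        (best+smaller x w)))
      (ℕ.m≤n⇒m≤1+n (best+smaller a w))
... | tri≈ a≮x refl _ rewrite ≮⇒<ᵇ≡false a≮x =
    ℕ.m≤n⇒m≤1+n (best+smaller a w)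
... | tri> a≮x _ x<a
    rewrite ≮⇒<ᵇ≡false a≮x | smaller-< w x<a | ℕ.+-suc (best a (ranked w)) (smaller a w) =
    s≤s (best+smaller a w)

smaller≤raj : ∀ a (w : Vec ℕ n) → smaller a w ≤ n ∸ best a (ranked w)
smaller≤raj {n} a w = ℕ.m+n≤o⇒m≤o∸n (smaller a w)
  (subst (_≤ n) (ℕ.+-comm (best a (ranked w)) (smaller a w)) (best+smaller a w))

fam-raj-code : ∀ (w : Vec ℕ n) → Fam w (raj-code w)
fam-raj-code []      = []
fam-raj-code (a ∷ w) = top (smaller≤raj a w) ℕ.≤-refl

-- Chain m w v c: multiplying v on the left by a subword of s_{m-1} ⋯ s₁ s₀
-- with c letters gives w.
data Chain {n} : ℕ → Vec ℕ n → Vec ℕ n → ℕ → Set where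
  done : ∀ {w} → Chain 0 w w 0
  skip : ∀ {m w v c} → Chain m w v c → Chain (suc m) w v c
  use  : ∀ {m w w′ v c} → leftMul m w ≡ w′ → Chain m w v c → Chain (suc m) w′ v (suc c)

row-top : ∀ p m (i : Fin n) → row p (suc m) i ≡ (p ℕ.+ m , i) ∷ row p m i
row-top p zero    i = cong (λ k → (k , i) ∷ []) (sym (ℕ.+-identityʳ p))
row-top p (suc m) i = trans (cong (_++ (p , i) ∷ []) (row-top (suc p) m i))
  (cong (λ k → (k , i) ∷ row p (suc m) i) (sym (ℕ.+-suc p m)))

iota-All : ∀ b n → VAll (b ≤_) (iota b n)
iota-All b zero    = []
iota-All b (suc n) = ℕ.≤-refl ∷ VAll.map ℕ.<⇒≤ (iota-All (suc b) n)

iota-unique : ∀ b n → Unique (iota b n)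
iota-unique b zero    = []
iota-unique b (suc n) = VAll.map ℕ.<⇒≢ (iota-All (suc b) n) ∷ iota-unique (suc b) n

map-suc-iota : ∀ b n → map suc (iota b n) ≡ iota (suc b) n
map-suc-iota b zero    = refl
map-suc-iota b (suc n) = cong (suc b ∷_) (map-suc-iota (suc b) n)

-- On the identity, exchanging neighbouring positions is the same as exchanging neighbouring values.
-- The offset `b` only serves the induction.
step-iota : ∀ b i → suc i < n → Step i (iota b n) (leftMul (b ℕ.+ i) (iota b n))
step-iota {suc (suc n)} b zero lt
  rewrite ℕ.+-identityʳ b | leftMul-i b (iota (suc b) (suc n)) | swapValue-suc b
        | map-swapValue-id (VAll.map (λ lt → ℕ.<⇒≢ (ℕ.<⇒≤ lt) ∘ sym) (iota-All (suc (suc b)) n))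
                           (VAll.map (λ lt → ℕ.<⇒≢ lt ∘ sym) (iota-All (suc (suc b)) n)) =
  cross (ℕ.n<1+n b)
step-iota {suc n} b (suc i) (s≤s lt)
  rewrite ℕ.+-suc b i
        | leftMul-other {i = suc (b ℕ.+ i)} {b} (ℕ.<⇒≢ (s≤s (ℕ.m≤m+n b i)))
            (ℕ.<⇒≢ (ℕ.m≤n⇒m≤1+n (s≤s (ℕ.m≤m+n b i)))) (iota (suc b) n) =
  there (step-iota (suc b) i lt)

-- A used letter of the first row turns the identity into its left multiple, and `reach-leftMul`
-- carries this left factor through everything read later, up to the final word. The premise holds
-- for every `c` because the exponent of the first variable grows with the letters used.
chain-reach : ∀ {k} {w v : Vec ℕ (suc n)} {e} → Chain k w v e → k ≤ n →
  ∀ {r : List (ℕ × Fin (suc m))} {γ α : Vec ℕ m} →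
  (∀ c → Reach r (iota 0 (suc n)) (c ∷ γ) v (c ∷ α)) →
  ∀ c → Reach (row 0 k zero ++ r) (iota 0 (suc n)) (c ∷ γ) w (c ℕ.+ e ∷ α)
chain-reach {w = w} done k≤n {r} {γ} {α} f c =
  subst (λ e → Reach r (iota 0 _) (c ∷ γ) w (e ∷ α)) (sym (ℕ.+-identityʳ c)) (f c)
chain-reach {n = n} {m = m} {k = suc k} (skip q) k≤n {r} f c rewrite row-top {n = suc m} 0 k zero =
  skip (chain-reach q (ℕ.<⇒≤ k≤n) f c)
chain-reach {n = n} {m = m} {k = suc k} {e = suc e} (use {w = w} refl q) k≤n {r} {γ} {α} f c
  rewrite row-top {n = suc m} 0 k zero =
  use (step-iota 0 k (s≤s k≤n)) (reach-leftMul k (iota-unique 0 (suc n))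
    (subst (λ d → Reach (row 0 k zero ++ r) (iota 0 (suc n)) (suc c ∷ γ) w (d ∷ α)) (sym (ℕ.+-suc c e))
      (chain-reach q (ℕ.<⇒≤ k≤n) f (suc c))))

chain-lower : ∀ a (v : Vec ℕ n) → Chain a (a ∷ map (punchIn a) v) (0 ∷ map suc v) a
chain-lower zero    v = done
chain-lower (suc a) v = use (trans (leftMul-i a (map (punchIn a) v))
  (cong (suc a ∷_) (trans (sym (Vec.map-∘ (swapValue a) (punchIn a) v)) (Vec.map-cong raise v))))
  (chain-lower a v)
  where
  raise : ∀ x → swapValue a (punchIn a x) ≡ punchIn (suc a) x
  raise x with ℕ.<-cmp x a
  ... | tri< x<a _ _ rewrite punchIn-< x<a | punchIn-< (ℕ.m≤n⇒m≤1+n x<a) =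
    swapValue-other (ℕ.<⇒≢ x<a) (ℕ.<⇒≢ (ℕ.m≤n⇒m≤1+n x<a))
  ... | tri≈ _ refl _ rewrite punchIn-≥ (ℕ.≤-refl {a}) | punchIn-< (ℕ.n<1+n a) = swapValue-suc a
  ... | tri> _ _ a<x rewrite punchIn-≥ (ℕ.<⇒≤ a<x) | punchIn-≥ a<x =
    swapValue-other (ℕ.<⇒≢ (ℕ.m≤n⇒m≤1+n a<x) ∘ sym) (ℕ.<⇒≢ a<x ∘ sym ∘ ℕ.suc-injective)

chain-skip : ∀ d {k} {w v : Vec ℕ n} {c} → Chain k w v c → Chain (d ℕ.+ k) w v c
chain-skip zero    q = q
chain-skip (suc d) q = skip (chain-skip d q)

-- The first entry is bubbled down to 0, all other entries keep their order.
chain-head : ∀ {a} {w : Vec ℕ n} → IsPerm (a ∷ w) →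
  Chain a (a ∷ w) (0 ∷ map suc (map (punchOut a) w)) a
chain-head {a = a} {w} (a∉ ∷ _ , _) =
  subst (λ u → Chain a (a ∷ u) (0 ∷ map suc (map (punchOut a) w)) a) (map-punchIn-punchOut a∉)
    (chain-lower a (map (punchOut a) w))

-- The greedy bubbling pass

data Before {A : Set} (p q : A) : ∀ {n} → Vec A n → Set where
  here  : ∀ {ps : Vec A n} → q ∈ ps → Before p q (p ∷ ps)
  there : ∀ {o} {ps : Vec A n} → Before p q ps → Before p q (o ∷ ps)

before-total : ∀ {A : Set} {p q : A} {ps : Vec A n} → p ≢ q → p ∈ ps → q ∈ ps →
  Before p q ps ⊎ Before q p ps
before-total ne (here refl) (here refl) = ⊥-elim (ne refl)
before-total ne (here refl) (there q)   = inj₁ (here q)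
before-total ne (there p)   (here refl) = inj₂ (here p)
before-total ne (there p)   (there q) with before-total ne p q
... | inj₁ b = inj₁ (there b)
... | inj₂ b = inj₂ (there b)

before-∈ : ∀ {A : Set} {p q : A} {ps : Vec A n} → Before p q ps → p ∈ ps × q ∈ ps
before-∈ (here q)  = here refl , there q
before-∈ (there b) with before-∈ b
... | p , q = there p , there q

before-rank : ∀ {y s z r} {w : Vec ℕ n} → Before (y , s) (z , r) (ranked w) → y < z → r < s
before-rank {w = a ∷ w} (here q)  lt = best-≥ q lt
before-rank {w = a ∷ w} (there b) lt = before-rank b lt

-- If i + 1 comes before i, left multiplication by sᵢ reaches `w` from two words: from `w` itself,
-- treated here, and from `w` with the two values exchanged, treated in `leftMul-crossed`. The
-- greedy pass chooses between them.
leftMul-absorbed : ∀ {i ρ r} {w : Vec ℕ n} → Unique w → Before (suc i , ρ) (i , r) (ranked w) →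
  leftMul i w ≡ w
leftMul-absorbed {i = i} {w = a ∷ w} u (here q) = leftMul-suc i w
leftMul-absorbed {i = i} {w = a ∷ w} (a∉ ∷ u) (there b) with before-∈ b
... | p , q = trans
  (leftMul-other (All-∈ a∉ (∈-ranked⁻ q)) (All-∈ a∉ (∈-ranked⁻ p)) w)
  (cong (a ∷_) (leftMul-absorbed u b))

leftMul-crossed : ∀ {i ρ r} {w : Vec ℕ n} → Unique w → Before (suc i , ρ) (i , r) (ranked w) →
  leftMul i (map (swapValue i) w) ≡ w
leftMul-crossed {i = i} {w = a ∷ w} u (here q) rewrite swapValue-suc i =
  trans (leftMul-i i (map (swapValue i) w)) (cong (suc i ∷_) (map-swapValue-involutive i w))
leftMul-crossed {i = i} {w = a ∷ w} (a∉ ∷ u) (there b) with before-∈ b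
... | p , q
  rewrite swapValue-other (All-∈ a∉ (∈-ranked⁻ q)) (All-∈ a∉ (∈-ranked⁻ p)) = trans
  (leftMul-other (All-∈ a∉ (∈-ranked⁻ q)) (All-∈ a∉ (∈-ranked⁻ p)) (map (swapValue i) w))
  (cong (a ∷_) (leftMul-crossed u b))

-- Exchanging the values i + 1 and i, in this order, creates only increasing
-- sequences through i and i + 1, and these are too short to matter if r < ρ.
ranked-swap : ∀ {i ρ r} {w : Vec ℕ n} → Unique w → Before (suc i , ρ) (i , r) (ranked w) → r < ρ →
  ranked (map (swapValue i) w) ≡ map (map₁ (swapValue i)) (ranked w)
ranked-swap {i = i} {r = r} {w = _ ∷ w} (a∉ ∷ u) (here q) r<ρ
  rewrite ranked-map (swapValue i) swapValue-reflect-≢suc (VAll.map (_∘ sym) a∉)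
        | swapValue-suc i =
  cong (λ r → (i , r) ∷ map (map₁ (swapValue i)) (ranked w))
    (ℕ.≤-antisym (best-≤ _ upper) (best-≤ (ranked w) lower))
  where
  ρ = best (suc i) (ranked w)
  upper : ∀ {y s} → (y , s) ∈ map (map₁ (swapValue i)) (ranked w) → i < y → suc s ≤ ρ
  upper p i<y with ∈-map⁻ (map₁ (swapValue i)) p
  ... | (x , s) , q′ , refl with swapValue i x | swapView i x
  ...   | _ | is-i      = subst (_< ρ) (ranked-functional u q q′) r<ρ
  ...   | _ | is-suc    = ⊥-elim (ℕ.<-irrefl refl i<y)
  ...   | _ | other _ ne = best-≥ q′ (ℕ.≤∧≢⇒< i<y (ne ∘ sym))
  lower : ∀ {y s} → (y , s) ∈ ranked w → suc i < y → suc s ≤ best i (map (map₁ (swapValue i)) (ranked w))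
  lower {y} {s} p lt = best-≥ (subst (λ x → (x , s) ∈ map (map₁ (swapValue i)) (ranked w))
    (swapValue-other (ℕ.<⇒≢ (ℕ.<-trans (ℕ.n<1+n i) lt) ∘ sym) (ℕ.<⇒≢ lt ∘ sym))
    (∈-map⁺ (map₁ (swapValue i)) p)) (ℕ.<-trans (ℕ.n<1+n i) lt)
ranked-swap {i = i} {w = a ∷ w} (a∉ ∷ u) (there b) r<ρ
  rewrite ranked-swap u b r<ρ =
  cong (λ r → (swapValue i a , r) ∷ map (map₁ (swapValue i)) (ranked w))
    (best-map (swapValue i) a (swapValue i a) (ranked w) (VAll.universal (λ (x , _) → same x) (ranked w)))
  where
  a≢suc = All-∈ a∉ (∈-ranked⁻ (proj₁ (before-∈ b)))
  a≢i   = All-∈ a∉ (∈-ranked⁻ (proj₂ (before-∈ b)))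
  same : ∀ x → (swapValue i a <ᵇ swapValue i x) ≡ (a <ᵇ x)
  same x rewrite swapValue-other a≢i a≢suc with swapValue i x | swapView i x
  ... | _ | is-i      = <ᵇ-cong (λ lt → ℕ.≤∧≢⇒< (ℕ.≤-pred lt) a≢i) ℕ.m≤n⇒m≤1+n
  ... | _ | is-suc    = <ᵇ-cong ℕ.m≤n⇒m≤1+n (λ lt → ℕ.≤∧≢⇒< (ℕ.≤-pred lt) a≢i)
  ... | _ | other _ _ = refl

record Lowering {n} (k a : ℕ) (w : Vec ℕ n) (c : ℕ) : Set where
  constructor lowering
  field
    target : Vec ℕ n
    perm   : IsPerm target
    ranks≡ : ranks target ≡ ranks w
    chain  : Chain k (a ∷ w) (0 ∷ map suc target) c

ranks-punchOut : ∀ {a} {w : Vec ℕ n} → VAll (a ≢_) w → ranks (map (punchOut a) w) ≡ ranks w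
ranks-punchOut {a = a} {w} a∉ =
  trans (sym (ranks-punchIn a (map (punchOut a) w))) (cong ranks (map-punchIn-punchOut a∉))

perm-swap : ∀ {i a} {w : Vec ℕ n} → IsPerm (a ∷ w) → suc i ≤ n → a < i →
  IsPerm (a ∷ map (swapValue i) w)
perm-swap {i = i} {a} {w} (a∉ ∷ u , a<n ∷ w<n) lt a<i =
  VAllₚ.map⁺ (VAll.map (λ ne e → ne (swapValue-injective i (trans fixed e))) a∉)
    ∷ unique-map {P = λ _ → ⊤} (swapValue i) (λ _ _ → swapValue-injective i) (VAll.universal (λ _ → tt) w) u ,
  a<n ∷ VAllₚ.map⁺ (VAll.map (swapValue-< (s≤s lt)) w<n)
  where
  fixed : swapValue i a ≡ a
  fixed = swapValue-other (ℕ.<⇒≢ a<i) (ℕ.<⇒≢ (ℕ.m≤n⇒m≤1+n a<i))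

-- The letters d + a, …, a + 1 are processed from the top.  The champion is the
-- value one above the next letter, ρ is its rank, and q counts the letters
-- that still have to be skipped.  Skipping a letter passes the championship to
-- the next value.  A skip is only forced when that value comes before the
-- champion, and then it has a larger rank; so q skips suffice as long as q
-- bounds how much the ranks can still grow.
lower-tail : ∀ d {a q ρ} {w : Vec ℕ n} → IsPerm (a ∷ w) → (suc (d ℕ.+ a) , ρ) ∈ ranked w → q ≤ d →
  q ≡ d ⊎ (∀ {y r} → (y , r) ∈ ranked w → a < y → r ≤ ρ ℕ.+ q) →
  Lowering (suc (d ℕ.+ a)) a w (a ℕ.+ (d ∸ q))
-- Letter `a` has to be skipped, since left multiplication by it never produces a word with `a` in
-- front. The `a` letters below it are all used.
lower-tail zero {a} {w = w} π@(a∉ ∷ _ , _) champ z≤n _ = lowering (map (punchOut a) w) (perm-tail π)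
  (ranks-punchOut a∉) (skip (subst (Chain a (a ∷ w) _) (sym (ℕ.+-identityʳ a)) (chain-head π)))
lower-tail {n} (suc d) {a} {q} {ρ} {w} π@(a∉ ∷ u , a<n ∷ w<n) champ q≤d cond
  with ∈-ranked⁺ (next (perm-∈ π (ℕ.<-trans (ℕ.n<1+n (suc d ℕ.+ a)) (All-∈ w<n (∈-ranked⁻ champ)))))
  where
  next : suc (d ℕ.+ a) ∈ a ∷ w → suc (d ℕ.+ a) ∈ w
  next (here e)  = ⊥-elim (ℕ.<⇒≢ (s≤s (ℕ.m≤n+m a d)) (sym e))
  next (there p) = p
... | s , nxt = choose (q ℕ.≟ suc d) cond
  where
  i = suc (d ℕ.+ a)
  a<i : a < i
  a<i = s≤s (ℕ.m≤n+m a d)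
  skipping : ∀ {q} → q ≤ d → q ≡ d ⊎ (∀ {y r} → (y , r) ∈ ranked w → a < y → r ≤ s ℕ.+ q) →
    Lowering (suc i) a w (a ℕ.+ (d ∸ q))
  skipping q≤d cond with lower-tail d π nxt q≤d cond
  ... | lowering v πv e c = lowering v πv e (skip c)
  used : ∀ {w′} → q ≤ d → leftMul i (a ∷ w′) ≡ a ∷ w → ranks w′ ≡ ranks w →
    Lowering i a w′ (a ℕ.+ (d ∸ q)) → Lowering (suc i) a w (a ℕ.+ (suc d ∸ q))
  used q≤d e re (lowering v πv e′ c) = lowering v πv (trans e′ re)
    (subst (Chain (suc i) (a ∷ w) (0 ∷ map suc v))
      (trans (sym (ℕ.+-suc a (d ∸ q))) (cong (a ℕ.+_) (sym (ℕ.+-∸-assoc 1 q≤d)))) (use e c))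
  leftMul-tail : ∀ w′ → leftMul i (a ∷ w′) ≡ a ∷ leftMul i w′
  leftMul-tail = leftMul-other (ℕ.<⇒≢ a<i) (ℕ.<⇒≢ (ℕ.m≤n⇒m≤1+n a<i))
  greedy : q ≤ d → (∀ {y r} → (y , r) ∈ ranked w → a < y → r ≤ ρ ℕ.+ q) →
    Lowering (suc i) a w (a ℕ.+ (suc d ∸ q))
  greedy q≤d bound with before-total (λ e → ℕ.1+n≢n (cong proj₁ e)) champ nxt
  greedy q≤d bound | inj₂ b = forced q refl
    where
    ρ<s : ρ < s
    ρ<s = before-rank b (ℕ.n<1+n i)
    forced : ∀ q′ → q ≡ q′ → Lowering (suc i) a w (a ℕ.+ (suc d ∸ q))
    forced zero     refl = ⊥-elim (ℕ.<⇒≱ ρ<s (subst (s ≤_) (ℕ.+-identityʳ ρ) (bound nxt a<i)))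
    forced (suc q′) refl = skipping (ℕ.<⇒≤ q≤d) (inj₂ λ {y} {r} p lt → ℕ.≤-trans (bound p lt)
      (subst (_≤ s ℕ.+ q′) (sym (ℕ.+-suc ρ q′)) (ℕ.+-monoˡ-≤ q′ ρ<s)))
  -- The letter is used, absorbed or crossed according to the larger of the two ranks. In either
  -- case the next champion, the value i, has rank max(ρ, s), so the bound persists with the same
  -- `q`.
  greedy q≤d bound | inj₁ b with ℕ.<-≤-connex s ρ
  ... | inj₂ ρ≤s = used q≤d (trans (leftMul-tail w) (cong (a ∷_) (leftMul-absorbed u b))) refl
    (lower-tail d π nxt q≤d (inj₂ λ p lt → ℕ.≤-trans (bound p lt) (ℕ.+-monoˡ-≤ q ρ≤s)))
  ... | inj₁ s<ρ = used q≤d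
    (trans (leftMul-tail _) (cong (a ∷_) (leftMul-crossed u b)))
    (trans (cong (map proj₂) swapped) (map-proj₂-map₁ (swapValue i) (ranked w)))
    (lower-tail d (perm-swap π (ℕ.≤-pred (All-∈ w<n (∈-ranked⁻ champ))) a<i)
      (subst (_ ∈_) (sym swapped) (subst (λ x → (x , ρ) ∈ map (map₁ (swapValue i)) (ranked w))
        (swapValue-suc i) (∈-map⁺ (map₁ (swapValue i)) champ)))
      q≤d (inj₂ bound′))
    where
    swapped = ranked-swap u b s<ρ
    bound′ : ∀ {y r} → (y , r) ∈ ranked (map (swapValue i) w) → a < y → r ≤ ρ ℕ.+ q
    bound′ {y} {r} p lt with ∈-map⁻ (map₁ (swapValue i)) (subst (_ ∈_) swapped p)
    ... | (x , _) , p′ , refl with swapValue i x | swapView i x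
    ...   | _ | is-i      = bound p′ a<i
    ...   | _ | is-suc    = bound p′ (ℕ.m≤n⇒m≤1+n a<i)
    ...   | _ | other _ _ = bound p′ lt
  choose : Dec (q ≡ suc d) → q ≡ suc d ⊎ (∀ {y r} → (y , r) ∈ ranked w → a < y → r ≤ ρ ℕ.+ q) →
    Lowering (suc i) a w (a ℕ.+ (suc d ∸ q))
  -- As many skips are due as letters remain. Skipping may lower the rank of the champion and
  -- thereby break the bound; `inj₁` takes its place.
  choose (yes refl) _            = skipping ℕ.≤-refl (inj₁ refl)
  choose (no ne)    (inj₁ e)     = ⊥-elim (ne e)
  choose (no ne)    (inj₂ bound) = greedy (ℕ.≤-pred (ℕ.≤∧≢⇒< q≤d ne)) bound

lower-head : ∀ {a} {w : Vec ℕ n} → IsPerm (a ∷ w) → Chain n (a ∷ w) (0 ∷ map suc (map (punchOut a) w)) a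
lower-head {n} {a} {w} π@(_ , a<n ∷ _) =
  subst (λ k → Chain k (a ∷ w) (0 ∷ map suc (map (punchOut a) w)) a) (ℕ.m∸n+n≡m (ℕ.≤-pred a<n))
    (chain-skip (n ∸ a) (chain-head π))

-- If `a` = `n`, the bounds force every letter to be used. Otherwise `d` = n - 1 - a letters lie
-- above letter `a`, of which `e` = c - a are to be used and `d ∸ e` skipped; the first champion is
-- the largest value `n`. A rank r above `a` has r + 1 ≤ `best a`, so c ≤ n - `best a` gives r ≤ d -
-- e, as the greedy pass requires.
lower-raj : ∀ {a c} {w : Vec ℕ n} → IsPerm (a ∷ w) → smaller a w ≤ c → c ≤ n ∸ best a (ranked w) →
  Lowering n a w c
lower-raj {n} {a} {c} {w} π@(a∉ ∷ u , a<n ∷ w<n) lo hi with ℕ.m≤n⇒m<n∨m≡n (ℕ.≤-pred a<n)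
... | inj₂ refl = lowering (map (punchOut a) w) (perm-tail π) (ranks-punchOut a∉)
  (subst (Chain n (a ∷ w) _)
    (ℕ.≤-antisym (subst (_≤ c) (smaller-head π) lo) (ℕ.≤-trans hi (ℕ.m∸n≤m n (best a (ranked w))))) (lower-head π))
... | inj₁ a<n′ with ℕ.m≤n⇒∃[o]m+o≡n a<n′ | ℕ.m≤n⇒∃[o]m+o≡n (subst (_≤ c) (smaller-head π) lo)
...   | d , refl | e , refl with ∈-ranked⁺ {w = w} (at-top (perm-∈ π (ℕ.n<1+n n)))
  where
  at-top : n ∈ a ∷ w → n ∈ w
  at-top (here e)  = ⊥-elim (ℕ.<⇒≢ a<n′ (sym e))
  at-top (there p) = p
...     | ρ , champ = subst₂ (λ k c → Lowering k a w (a ℕ.+ c)) (cong suc (ℕ.+-comm d a)) (ℕ.m∸[m∸n]≡n e≤d)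
  (lower-tail d π (subst (λ k → (k , ρ) ∈ ranked w) (cong suc (ℕ.+-comm a d)) champ) (ℕ.m∸n≤m d e)
    (inj₂ λ p lt → ℕ.≤-trans (ℕ.m+n≤o⇒m≤o∸n _ (room p lt)) (ℕ.m≤n+m (d ∸ e) ρ)))
  where
  M = best a (ranked w)
  M+c≤n : M ℕ.+ (a ℕ.+ e) ≤ n
  M+c≤n = subst (M ℕ.+ (a ℕ.+ e) ≤_) (ℕ.m+[n∸m]≡n (ℕ.m+n≤o⇒m≤o M (best+smaller a w)))
    (ℕ.+-monoʳ-≤ M hi)
  room : ∀ {y r} → (y , r) ∈ ranked w → a < y → r ℕ.+ e ≤ d
  room {y} {r} p lt = ℕ.+-cancelˡ-≤ a (r ℕ.+ e) d (subst (_≤ a ℕ.+ d)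
    (trans (sym (ℕ.+-assoc r a e)) (trans (cong (ℕ._+ e) (ℕ.+-comm r a)) (ℕ.+-assoc a r e)))
    (ℕ.≤-pred (ℕ.≤-trans (ℕ.+-monoˡ-≤ (a ℕ.+ e) (best-≥ p lt)) M+c≤n)))
  e≤d : e ≤ d
  e≤d = ℕ.m+n≤o⇒n≤o ρ (room champ a<n′)

reach-tail : ∀ {v α : Vec ℕ n} → Reach (rows n) (iota 0 n) (replicate n 0) v α → ∀ c →
  Reach (List.map shift (rows n)) (iota 0 (suc n)) (c ∷ replicate n 0) (0 ∷ map suc v) (c ∷ α)
reach-tail {n} {v} {α} q c = subst
  (λ z → Reach (List.map shift (rows n)) (0 ∷ z) (c ∷ replicate n 0) (0 ∷ map suc v) (c ∷ α))
  (map-suc-iota 0 n) (reach-shift c q)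

-- For `low` the pass leaves the flattened tail, which inherits its member of `Fam`. For `top` only
-- the ranks of the remaining `v` are known, but the rest of the exponent is the raj code, a
-- function of the ranks.
fam-reach : ∀ {w : Vec ℕ n} → IsPerm w → ∀ {α} → Fam w α →
  Reach (rows n) (iota 0 n) (replicate n 0) w α
fam-reach π [] = done
fam-reach {suc n} {a ∷ w} π@(a∉ ∷ u , _) (low {α = α} f) rewrite smaller-head π =
  chain-reach (lower-head π) ℕ.≤-refl (reach-tail (fam-reach (perm-tail π)
    (fam-punchIn a (subst (λ v → Fam v α) (sym (map-punchIn-punchOut a∉)) f)))) 0
fam-reach {suc n} {a ∷ w} π (top {c = c} lo hi) with lower-raj π lo hi
... | lowering v πv e chain = subst
  (λ rs → Reach (rows (suc n)) (iota 0 (suc n)) (replicate (suc n) 0) (a ∷ w) (c ∷ complement rs)) e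
  (chain-reach chain ℕ.≤-refl (reach-tail (fam-reach πv (fam-raj-code v))) 0)

-- Comparison with the codes of the statement

inversion-code : Vec ℕ n → Vec ℕ n
inversion-code []      = []
inversion-code (a ∷ w) = smaller a w ∷ inversion-code w

fam-inversion-code : ∀ (w : Vec ℕ n) → Fam w (inversion-code w)
fam-inversion-code []      = []
fam-inversion-code (a ∷ w) = low (fam-inversion-code w)

count-tabulate : ∀ {A B : Set} {P : A → Set} {Q : B → Set} (P? : Decidable P) (Q? : Decidable Q)
  (f : Fin n → A) (g : Fin n → B) → (∀ i → does (P? (f i)) ≡ does (Q? (g i))) →
  Vec.count P? (tabulate f) ≡ Vec.count Q? (tabulate g)
count-tabulate {zero}  P? Q? f g e = refl
count-tabulate {suc n} P? Q? f g e rewrite e zero with does (Q? (g zero))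
... | true  = cong suc (count-tabulate P? Q? (f ∘ suc) (g ∘ suc) (e ∘ suc))
... | false = count-tabulate P? Q? (f ∘ suc) (g ∘ suc) (e ∘ suc)

-- Stated for any `g` because the tail of a permutation is no longer a permutation of its index set.
invcode-tabulate : ∀ {N} (g : Fin n → Fin N) →
  tabulate (λ i → Vec.count (λ j → (i Fin.<? j) ×-dec (g j Fin.<? g i)) (Vec.allFin n)) ≡
  inversion-code (tabulate (toℕ ∘ g))
invcode-tabulate {zero}  g = refl
invcode-tabulate {suc n} g = cong₂ _∷_
  (count-tabulate _ (ℕ._<? toℕ (g zero)) suc (toℕ ∘ g ∘ suc) λ j → refl)
  (trans (Vec.tabulate-cong λ i → count-tabulate _
      (λ j → (i Fin.<? j) ×-dec (g (suc j) Fin.<? g (suc i))) suc id λ j → refl)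
    (invcode-tabulate (g ∘ suc)))

invcode-word : ∀ (w : Permutation′ n) → invcode w ≡ inversion-code (word w)
invcode-word w = invcode-tabulate (w ⟨$⟩ʳ_)

max-∷ : ∀ k ks → max 0 (k ∷ ks) ≡ k ⊔ max 0 ks
max-∷ k ks = ℕ.≤-antisym
  (max≤v⁺ z≤n (ℕ.m≤m⊔n k _ ∷ All.map (λ le → ℕ.≤-trans le (ℕ.m≤n⊔m k _)) (xs≤max 0 ks)))
  (ℕ.⊔-lub (All.head (xs≤max 0 (k ∷ ks))) (max≤v⁺ z≤n (All.tail (xs≤max 0 (k ∷ ks)))))

max-++ : ∀ ks ls → max 0 (ks ++ ls) ≡ max 0 ks ⊔ max 0 ls
max-++ []       ls = refl
max-++ (k ∷ ks) ls = trans (max-∷ k (ks ++ ls)) (trans (cong (k ⊔_) (max-++ ks ls))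
  (trans (sym (ℕ.⊔-assoc k (max 0 ks) (max 0 ls))) (cong (_⊔ max 0 ls) (sym (max-∷ k ks)))))

-- The premise excludes the empty list, whose maximum is the default 0 on both sides.
max-map-suc : ∀ ks {k} → max 0 ks ≡ suc k → max 0 (List.map suc ks) ≡ suc (suc k)
max-map-suc ks {k} e = trans (go ks (λ { refl → ℕ.0≢1+n e })) (cong suc e)
  where
  go : ∀ ks → ks ≢ [] → max 0 (List.map suc ks) ≡ suc (max 0 ks)
  go []            ne = ⊥-elim (ne refl)
  go (k ∷ [])      ne = trans (max-∷ (suc k) []) (cong suc (trans (sym (ℕ.⊔-identityʳ k)) (sym (max-∷ k []))))
  go (k ∷ l ∷ ks)  ne = trans (max-∷ (suc k) (List.map suc (l ∷ ks)))
    (trans (cong (suc k ⊔_) (go (l ∷ ks) λ ())) (cong suc (sym (max-∷ k (l ∷ ks)))))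

module _ (w : Permutation′ n) where

  ascends? : Fin n → Fin n → Bool
  ascends? i j = does ((i Fin.<? j) ×-dec (w ⟨$⟩ʳ i Fin.<? w ⟨$⟩ʳ j))

  lengths : Fin n → List (List (Fin n)) → List ℕ
  lengths i αs = List.map List.length (List.filter (increasing? w) (List.map (i ∷_) αs))

  lengths-++ : ∀ i αs βs → lengths i (αs ++ βs) ≡ lengths i αs ++ lengths i βs
  lengths-++ i αs βs = trans
    (cong (List.map List.length ∘ List.filter (increasing? w)) (List.map-++ (i ∷_) αs βs))
    (trans (cong (List.map List.length) (List.filter-++ (increasing? w) (List.map (i ∷_) αs) _))
      (List.map-++ List.length (List.filter (increasing? w) (List.map (i ∷_) αs)) _))

  lengths-ascent : ∀ i j αs → ascends? i j ≡ true →
    lengths i (List.map (j ∷_) αs) ≡ List.map suc (lengths j αs)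
  lengths-ascent i j []       e = refl
  lengths-ascent i j (α ∷ αs) e with lengths-ascent i j αs e
  ... | ih rewrite e with does (increasing? w (j ∷ α))
  ...   | true  = cong (suc (suc (List.length α)) ∷_) ih
  ...   | false = ih

  lengths-other : ∀ i j αs → ascends? i j ≡ false → lengths i (List.map (j ∷_) αs) ≡ []
  lengths-other i j []       e = refl
  lengths-other i j (α ∷ αs) e with lengths-other i j αs e
  ... | ih rewrite e = ih

  bestIndex : Fin n → List (Fin n) → ℕ
  bestIndex i []       = 0
  bestIndex i (j ∷ js) = (if ascends? i j then suc (bestIndex j js) else 0) ⊔ bestIndex i js

  -- The sublists are divided by whether they contain `j`. Those that do count only if i, j is an
  -- ascent, and they are then one longer than the sequences starting at `j`. The outer `suc` counts
  -- `i` itself.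
  max-lengths : ∀ i js → max 0 (lengths i (sublists js)) ≡ suc (bestIndex i js)
  max-lengths i []       = refl
  max-lengths i (j ∷ js)
    rewrite lengths-++ i (List.map (j ∷_) (sublists js)) (sublists js)
          | max-++ (lengths i (List.map (j ∷_) (sublists js))) (lengths i (sublists js))
          | max-lengths i js
    with ascends? i j in e
  ... | true  rewrite lengths-ascent i j (sublists js) e
                    | max-map-suc (lengths j (sublists js)) (max-lengths j js) = refl
  ... | false rewrite lengths-other i j (sublists js) e = refl

  ascends?-< : ∀ {i j} → toℕ i < toℕ j → ascends? i j ≡ (toℕ (w ⟨$⟩ʳ i) <ᵇ toℕ (w ⟨$⟩ʳ j))
  ascends?-< lt rewrite <⇒<ᵇ≡true lt = refl

  ascends?-≮ : ∀ {i j} → ¬ toℕ i < toℕ j → ascends? i j ≡ false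
  ascends?-≮ nlt rewrite ≮⇒<ᵇ≡false nlt = refl

  values : (Fin m → Fin n) → Vec ℕ m
  values g = tabulate (λ p → toℕ (w ⟨$⟩ʳ g p))

  bestIndex-after : ∀ i (g : Fin m → Fin n) → (∀ p → toℕ i < toℕ (g p)) →
    (∀ {p q} → toℕ p < toℕ q → toℕ (g p) < toℕ (g q)) →
    bestIndex i (List.tabulate g) ≡ best (toℕ (w ⟨$⟩ʳ i)) (ranked (values g))
  bestIndex-after {zero}  i g i< g< = refl
  bestIndex-after {suc m} i g i< g<
    rewrite ascends?-< (i< zero)
          | bestIndex-after (g zero) (g ∘ suc) (λ p → g< (s≤s z≤n)) (λ lt → g< (s≤s lt))
          | bestIndex-after i (g ∘ suc) (i< ∘ suc) (λ lt → g< (s≤s lt)) = refl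

  -- The search for a successor runs over all indices; those not behind `g p` fail the comparison of
  -- positions and contribute 0.
  bestIndex-tabulate : ∀ (g : Fin m → Fin n) → (∀ {p q} → toℕ p < toℕ q → toℕ (g p) < toℕ (g q)) →
    ∀ p → bestIndex (g p) (List.tabulate g) ≡ lookup (ranks (values g)) p
  bestIndex-tabulate g g< zero
    rewrite ascends?-≮ (ℕ.<-irrefl {toℕ (g zero)} refl) =
    bestIndex-after (g zero) (g ∘ suc) (λ p → g< (s≤s z≤n)) (λ lt → g< (s≤s lt))
  bestIndex-tabulate g g< (suc p)
    rewrite ascends?-≮ (ℕ.<-asym (g< {zero} {suc p} (s≤s z≤n))) =
    bestIndex-tabulate (g ∘ suc) (λ lt → g< (s≤s lt)) p

  rajcode‾-ranks : ∀ i → rajcode‾ w i ≡ lookup (ranks (word w)) i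
  rajcode‾-ranks i = trans (cong (_∸ 1) (max-lengths i (List.allFin n))) (bestIndex-tabulate id id i)

complement-tabulate : ∀ (rs : Vec ℕ n) →
  tabulate (λ k → (n ∸ suc (toℕ k)) ∸ lookup rs k) ≡ complement rs
complement-tabulate []       = refl
complement-tabulate (r ∷ rs) = cong (_ ∷_) (complement-tabulate rs)

rajcode-word : ∀ (w : Permutation′ n) → rajcode w ≡ raj-code (word w)
rajcode-word {n} w = trans
  (Vec.tabulate-cong λ k → cong (n ∸ suc (toℕ k) ∸_) (rajcode‾-ranks w k))
  (complement-tabulate (ranks (word w)))

-- The vectors L_w(i)

lastBelow : Vec ℕ n → Vec ℕ n → Maybe (Fin n)
lastBelow []      []      = nothing
lastBelow (c ∷ α) (r ∷ β) =
  maybe′ (just ∘ suc) (if c <ᵇ r then just zero else nothing) (lastBelow α β)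

last-∷ : ∀ {A : Set} (a : A) as → List.last (a ∷ as) ≡ maybe′ just (just a) (List.last as)
last-∷ a []           = refl
last-∷ a (b ∷ [])     = refl
last-∷ a (b ∷ c ∷ as) = last-∷ a (c ∷ as)

filter-map-suc : ∀ {P : Fin (suc n) → Set} {Q : Fin n → Set} (P? : Decidable P) (Q? : Decidable Q) →
  (∀ i → does (P? (suc i)) ≡ does (Q? i)) → ∀ is →
  List.filter P? (List.map suc is) ≡ List.map suc (List.filter Q? is)
filter-map-suc P? Q? e []       = refl
filter-map-suc P? Q? e (i ∷ is) rewrite e i with does (Q? i)
... | true  = cong (suc i ∷_) (filter-map-suc P? Q? e is)
... | false = filter-map-suc P? Q? e is

last-filter : ∀ (α β : Vec ℕ n) →
  List.last (List.filter (λ j → lookup α j ℕ.<? lookup β j) (List.allFin n)) ≡ lastBelow α β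
last-filter []      []      = refl
last-filter {suc n} (c ∷ α) (r ∷ β) = trans (head (c <ᵇ r) refl) (cong (maybe′ (just ∘ suc) _) (last-filter α β))
  where
  P? = λ j → lookup (c ∷ α) j ℕ.<? lookup (r ∷ β) j
  Q? = λ j → lookup α j ℕ.<? lookup β j
  tail≡ : List.filter P? (List.tabulate suc) ≡ List.map suc (List.filter Q? (List.allFin n))
  tail≡ = trans (cong (List.filter P?) (sym (List.map-tabulate id suc)))
    (filter-map-suc P? Q? (λ _ → refl) (List.allFin n))
  maybe-map : ∀ {A B : Set} (f : A → B) b (m : Maybe A) →
    maybe′ just b (Maybe.map f m) ≡ maybe′ (just ∘ f) b m
  maybe-map f b (just _) = refl
  maybe-map f b nothing  = refl
  maybe-nothing : ∀ {A B : Set} (f : A → B) (m : Maybe A) → Maybe.map f m ≡ maybe′ (just ∘ f) nothing m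
  maybe-nothing f (just _) = refl
  maybe-nothing f nothing  = refl
  head : ∀ b → (c <ᵇ r) ≡ b → List.last (List.filter P? (List.allFin (suc n))) ≡
    maybe′ (just ∘ suc) (if b then just zero else nothing) (List.last (List.filter Q? (List.allFin n)))
  head true  e rewrite e | tail≡ = trans (last-∷ zero (List.map suc (List.filter Q? (List.allFin n))))
    (trans (cong (maybe′ just (just zero)) (List.last-map suc (List.filter Q? (List.allFin n))))
      (maybe-map suc (just zero) (List.last (List.filter Q? (List.allFin n)))))
  head false e rewrite e | tail≡ = trans (List.last-map suc (List.filter Q? (List.allFin n)))
    (maybe-nothing suc (List.last (List.filter Q? (List.allFin n))))

raiseLast : Vec ℕ n → Vec ℕ n → Vec ℕ n
raiseLast α β = maybe′ (λ j → α [ j ]%= suc) α (lastBelow α β)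

lastBelow-refl : ∀ (β : Vec ℕ n) → lastBelow β β ≡ nothing
lastBelow-refl []      = refl
lastBelow-refl (r ∷ β) rewrite lastBelow-refl β | ≮⇒<ᵇ≡false (ℕ.<-irrefl {r} refl) = refl

fam-maximal : ∀ {w α : Vec ℕ n} → Fam w α → lastBelow α (raj-code w) ≡ nothing → α ≡ raj-code w
fam-maximal [] e = refl
fam-maximal (low {n} {a} {w} {α} f) e with lastBelow α (raj-code w) in eq
... | nothing with smaller a w <ᵇ (n ∸ best a (ranked w)) in lt
...   | false = cong₂ _∷_ (ℕ.≤-antisym (smaller≤raj a w) (<ᵇ≡false⇒≥ _ _ lt)) (fam-maximal f eq)
fam-maximal (top {n} {a} {c} {w} lo hi) e rewrite lastBelow-refl (raj-code w)
  with c <ᵇ (n ∸ best a (ranked w)) in lt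
... | false = cong (_∷ raj-code w) (ℕ.≤-antisym hi (<ᵇ≡false⇒≥ c _ lt))

-- As long as the tail admits a raise, `low` persists. When it does not, `fam-maximal` identifies
-- the tail with the raj code, so that raising the first entry produces `top`; from then on only
-- that entry moves.
fam-raiseLast : ∀ {w α : Vec ℕ n} → Fam w α → Fam w (raiseLast α (raj-code w))
fam-raiseLast [] = []
fam-raiseLast (low {n} {a} {w} {α} f) with lastBelow α (raj-code w) in eq | fam-raiseLast f
... | just j  | f′ = low f′
... | nothing | _ with smaller a w <ᵇ (n ∸ best a (ranked w)) in lt
...   | true rewrite fam-maximal f eq = top (ℕ.n≤1+n _) (<ᵇ≡true⇒< _ _ lt)
...   | false = low f
fam-raiseLast (top {n} {a} {c} {w} lo hi) rewrite lastBelow-refl (raj-code w)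
  with c <ᵇ (n ∸ best a (ranked w)) in lt
... | true  = top (ℕ.m≤n⇒m≤1+n lo) (<ᵇ≡true⇒< c _ lt)
... | false = top lo hi

fam-L : ∀ (w : Permutation′ n) i → Fam (word w) (L w i)
fam-L w zero    = subst (Fam (word w)) (sym (invcode-word w)) (fam-inversion-code (word w))
fam-L w (suc i) rewrite rajcode-word w | last-filter (L w i) (raj-code (word w)) =
  fam-raiseLast (fam-L w i)

perm-word : ∀ (w : Permutation′ n) → IsPerm (word w)
perm-word w = Unique.tabulate⁺ (Injection.injective (↔⇒↣ w) ∘ Fin.toℕ-injective) ,
  VAllₚ.tabulate⁺ λ i → Fin.toℕ<n (w ⟨$⟩ʳ i)

corollary9p10 : ∀ (n : ℕ) (w : Permutation′ n) (𝔊 : Poly n) → IsGrothendieck w 𝔊 →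
    ∀ (i : ℕ) → i ≤ raj w ∸ inv w → coeff 𝔊 (L w i) ≢ 0ℤ
corollary9p10 n w 𝔊 isG i _ e = reach-nonzero (fam-reach (perm-word w) (fam-L w i))
  (trans (sym (grothendieck-coeff isG (L w i))) e)
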